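{- Let $K$ be any field and $n\geq 1$. In the field $K(x_1,\ldots,x_n)$ of rational functions, let $e_k=\sum_{1\le i_1<\dots<i_k\le n}x_{i_1}\cdots x_{i_k}$ ($1\le k\le n$) be the elementary symmetric polynomials and $p_k=\sum_{i=1}^n x_i^k$ ($k\geq 1$) the power polynomials. Then $K(e_1,\ldots,e_n)=K(p_1,p_2,p_3,\ldots)$, where $K(S)$ denotes the subfield of $K(x_1,\ldots,x_n)$ generated over $K$ by the set $S$. -}

module Defs where

open import Level using (Level; _⊔_) renaming (suc to lsuc)
open import Algebra.Bundles using (CommutativeRing)
open import Data.Nat using (ℕ; zero; suc; _≤_)
open import Data.Fin using (Fin; zero; suc)
open import Data.List using (List; foldr; map)
open import Data.List.Base using (allFin)
open import Data.Product using (Σ; _×_)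
open import Relation.Nullary using (¬_)

record Field (c ℓ : Level) : Set (lsuc (c ⊔ ℓ)) where
  field
    commutativeRing : CommutativeRing c ℓ
  open CommutativeRing commutativeRing public
  field
    0≉1        : ¬ (0# ≈ 1#)
    inv        : (x : Carrier) → ¬ (x ≈ 0#) → Carrier
    inv-cancel : (x : Carrier) (nz : ¬ (x ≈ 0#)) → (x * inv x nz) ≈ 1#

-- The polynomial ring K[x₁,…,xₙ], presented as the free commutative
-- K-algebra on n generators: formal expressions modulo the least
-- congruence containing the commutative ring axioms and making
-- `con : K → K[x]` a (unital) ring homomorphism.

module Polynomials {c ℓ : Level} (K : Field c ℓ) (n : ℕ) where
  open Field K using (Carrier; _≈_; _+_; _*_; -_; 0#; 1#)

  infixl 6 _⊕_
  infixl 7 _⊗_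
  infix  4 _≋_

  data Poly : Set c where
    con  : Carrier → Poly
    var  : Fin n → Poly
    _⊕_  : Poly → Poly → Poly
    _⊗_  : Poly → Poly → Poly
    ⊖_   : Poly → Poly

  data _≋_ : Poly → Poly → Set (c ⊔ ℓ) where
    ≋-refl  : ∀ {p} → p ≋ p
    ≋-sym   : ∀ {p q} → p ≋ q → q ≋ p
    ≋-trans : ∀ {p q r} → p ≋ q → q ≋ r → p ≋ r
    ⊕-cong  : ∀ {p p′ q q′} → p ≋ p′ → q ≋ q′ → p ⊕ q ≋ p′ ⊕ q′
    ⊗-cong  : ∀ {p p′ q q′} → p ≋ p′ → q ≋ q′ → p ⊗ q ≋ p′ ⊗ q′
    ⊖-cong  : ∀ {p p′} → p ≋ p′ → ⊖ p ≋ ⊖ p′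
    con-cong : ∀ {a b} → a ≈ b → con a ≋ con b
    con-+    : ∀ a b → con (a + b) ≋ con a ⊕ con b
    con-*    : ∀ a b → con (a * b) ≋ con a ⊗ con b
    con--    : ∀ a → con (- a) ≋ ⊖ con a
    ⊕-assoc  : ∀ p q r → (p ⊕ q) ⊕ r ≋ p ⊕ (q ⊕ r)
    ⊕-comm   : ∀ p q → p ⊕ q ≋ q ⊕ p
    ⊕-idˡ    : ∀ p → con 0# ⊕ p ≋ p
    ⊖-invˡ   : ∀ p → (⊖ p) ⊕ p ≋ con 0#
    ⊗-assoc  : ∀ p q r → (p ⊗ q) ⊗ r ≋ p ⊗ (q ⊗ r)
    ⊗-comm   : ∀ p q → p ⊗ q ≋ q ⊗ p
    ⊗-idˡ    : ∀ p → con 1# ⊗ p ≋ p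
    distribˡ : ∀ p q r → p ⊗ (q ⊕ r) ≋ (p ⊗ q) ⊕ (p ⊗ r)

  _^_ : Poly → ℕ → Poly
  p ^ zero  = con 1#
  p ^ suc k = p ⊗ (p ^ k)

  sumP : List Poly → Poly
  sumP = foldr _⊕_ (con 0#)

  powerSum : ℕ → Poly
  powerSum k = sumP (map (λ i → var i ^ k) (allFin n))

-- Elementary symmetric polynomials e_k(x₁,…,x_m), defined by the usual
-- recursion on the number of variables (split the sum over
-- i₁ < ⋯ < i_k according to whether i₁ is the first variable):
--   e_0 = 1,  e_{k+1}() = 0,
--   e_{k+1}(x₀,x₁..x_m) = e_{k+1}(x₁..x_m) + x₀ · e_k(x₁..x_m).

module _ {c ℓ : Level} (K : Field c ℓ) where
  open Field K using (0#; 1#)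
  open module P {m} = Polynomials K m using (Poly; con; var; _⊕_; _⊗_; ⊖_)

  shift : ∀ {m} → Poly {m} → Poly {suc m}
  shift (con a) = con a
  shift (var i) = var (suc i)
  shift (p ⊕ q) = shift p ⊕ shift q
  shift (p ⊗ q) = shift p ⊗ shift q
  shift (⊖ p)   = ⊖ shift p

  esym : (m k : ℕ) → Poly {m}
  esym m       zero    = con 1#
  esym zero    (suc k) = con 0#
  esym (suc m) (suc k) = shift (esym m (suc k)) ⊕ (var zero ⊗ shift (esym m k))

module RationalFunctions {c ℓ : Level} (K : Field c ℓ) (n : ℕ) where
  open Field K using (Carrier; 0#)
  open Polynomials K n public

  record Frac : Set (c ⊔ ℓ) where
    constructor _/_∣_
    field
      num  : Poly
      den  : Poly
      den≢0 : ¬ (den ≋ con 0#)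
  open Frac public

  _≃_ : Frac → Frac → Set (c ⊔ ℓ)
  f ≃ g = num f ⊗ den g ≋ num g ⊗ den f

  _≃P_ : Frac → Poly → Set (c ⊔ ℓ)
  f ≃P p = num f ≋ p ⊗ den f

  -- K(S): smallest subset of K(x₁,…,xₙ) containing K and S and closed
  -- under +, ·, negation and inverses of nonzero elements.  Each rule
  -- asserts h ≃ (result computed by cross-multiplication), so the
  -- subset is closed under ≃.
  data Gen {s} (S : Frac → Set s) : Frac → Set (c ⊔ ℓ ⊔ s) where
    gen-K   : ∀ h (a : Carrier) → num h ≋ con a ⊗ den h → Gen S h
    gen-S   : ∀ h → S h → Gen S h
    gen-add : ∀ f g h → Gen S f → Gen S g →
              num h ⊗ (den f ⊗ den g) ≋ (num f ⊗ den g ⊕ num g ⊗ den f) ⊗ den h →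
              Gen S h
    gen-mul : ∀ f g h → Gen S f → Gen S g →
              num h ⊗ (den f ⊗ den g) ≋ (num f ⊗ num g) ⊗ den h →
              Gen S h
    gen-neg : ∀ f h → Gen S f →
              num h ⊗ den f ≋ (⊖ num f) ⊗ den h →
              Gen S h
    gen-inv : ∀ f h → Gen S f → ¬ (num f ≋ con 0#) →
              num h ⊗ num f ≋ den f ⊗ den h →
              Gen S h

  ElemSet : Frac → Set (c ⊔ ℓ)
  ElemSet h = Σ ℕ λ k → (1 ≤ k) × (k ≤ n) × (h ≃P esym K n k)

  PowerSet : Frac → Set (c ⊔ ℓ)
  PowerSet h = Σ ℕ λ k → (1 ≤ k) × (h ≃P powerSum k)

{-# OPTIONS --safe #-}

-- Newton's identities, in which p_k has coefficient ±1, put every p_k into K[e₁,…,eₙ].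
--
-- Conversely, multiplying ∏ (T − xᵢ) at T = x_a by x_a^{j+1} and summing over a shows that
-- the coefficients cᵢ = ± e_{n−i} satisfy ∑_{i≤n} cᵢ p_{i+j+1} = 0.  Cramer's rule solves this
-- linear system for the cᵢ over K(p₁,p₂,…), in every characteristic, provided that the Hankel
-- determinant of (p_{i+j+1})_{i,j<n} is nonzero.  If L is the matrix of coefficients of the
-- Lagrange polynomials ∏_{c≠b} (T − x_c), then L · Hankel · Lᵗ is diagonal with entries
-- x_b ∏_{c≠b} (x_b − x_c)², and the product of these is a non-zero-divisor after the
-- substitution x_i ↦ t^{i+1} into K[[t]].
--
-- Equality in K is not assumed decidable, so elimination with pivot search is not available.

module Submission where

open import Defs
open import Level using (Level; _⊔_; Lift; lift)
open import Algebra.Bundles using (CommutativeRing)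
open import Data.Bool using (if_then_else_)
open import Data.Fin as Fin using (Fin; zero; suc; punchIn; punchOut; toℕ; fromℕ<)
open import Data.Fin.Properties
  using (suc-injective; toℕ-injective; toℕ-fromℕ<; punchInᵢ≢i; punchIn-punchOut)
open import Data.Integer as ℤ using (ℤ; +_; -[1+_])
import Data.Integer.Properties as ℤₚ
import Data.List as List
open import Data.List.Properties using (map-tabulate)
open import Data.Maybe using (Maybe; just; nothing)
open import Data.Nat as ℕ using (ℕ; zero; suc; _≤_; _∸_; z≤n; s≤s)
import Data.Nat.Properties as ℕₚ
open import Data.Product using (_×_; _,_)
import Data.Sign as Sign
open import Data.Sum using (inj₁; inj₂)
open import Data.Unit using (⊤; tt)
open import Data.Vec.Functional as Vector using (_∷_; removeAt)
open import Function using (_∘_; id)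
open import Relation.Nullary using (¬_; yes; no; does; contradiction)
open import Relation.Nullary.Decidable using (dec-true; dec-false)
open import Relation.Binary.PropositionalEquality as ≡ using (_≡_; _≢_)

-- `Poly` is a quotient by an inductively generated congruence and comes without normal forms, so
-- nonzeroness of a polynomial is proved through a homomorphism out of it. The target K[[t]] is
-- modelled by coefficient functions with pointwise equality, where no degree or support has to be
-- computed. All linear algebra is division-free and stays in the polynomial ring: the Hankel
-- determinant and the Cramer numerators are ring expressions in the power sums, and a single
-- quotient at the end enters the field. The shift in p_{i+j+1} keeps every exponent positive, which
-- is what `PowerSet` offers; it is also the source of the factor x_b in the diagonal entries.

-- A ring solver with integer coefficients over an arbitrary commutative ring.

module IntegerCoefficients {c ℓ : Level} (R : CommutativeRing c ℓ) where
  open CommutativeRing R hiding (zero)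
  open import Algebra.Solver.Ring.AlmostCommutativeRing
    using (fromCommutativeRing; _-Raw-AlmostCommutative⟶_)
  open import Algebra.Properties.Ring ring
  open import Algebra.Properties.AbelianGroup +-abelianGroup using (⁻¹-∙-comm)
  open import Algebra.Properties.Semiring.Mult.TCOptimised semiring renaming (_×_ to _·_)
  open import Relation.Binary.Reasoning.Setoid setoid

  -- The optimised multiple makes `⟦ + 1 ⟧ℤ` reduce to `1#`, so `con (+ 1)` in a solver equation
  -- matches a literal `1#` definitionally.
  ⟦_⟧ℤ : ℤ → Carrier
  ⟦ + n ⟧ℤ      = n · 1#
  ⟦ -[1+ n ] ⟧ℤ = - (suc n · 1#)

  reflℤ : ∀ {i j} → i ≡ j → ⟦ i ⟧ℤ ≈ ⟦ j ⟧ℤ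
  reflℤ ≡.refl = refl

  cancel-suc : ∀ x y → x - y ≈ (1# + x) - (1# + y)
  cancel-suc x y = begin
    x - y                     ≈⟨ +-identityˡ _ ⟨
    0# + (x - y)              ≈⟨ +-congʳ (-‿inverseʳ 1#) ⟨
    (1# - 1#) + (x - y)       ≈⟨ +-assoc _ _ _ ⟩
    1# + (- 1# + (x - y))     ≈⟨ +-congˡ (+-assoc _ _ _) ⟨
    1# + ((- 1# + x) - y)     ≈⟨ +-congˡ (+-congʳ (+-comm _ _)) ⟩
    1# + ((x - 1#) - y)       ≈⟨ +-congˡ (+-assoc _ _ _) ⟩
    1# + (x + (- 1# - y))     ≈⟨ +-assoc _ _ _ ⟨
    (1# + x) + (- 1# - y)     ≈⟨ +-congˡ (⁻¹-∙-comm _ _) ⟩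
    (1# + x) - (1# + y)       ∎

  ⊖-homo : ∀ m n → ⟦ m ℤ.⊖ n ⟧ℤ ≈ m · 1# - n · 1#
  ⊖-homo zero zero       = sym (-‿inverseʳ 0#)
  ⊖-homo zero (suc n)    = sym (+-identityˡ _)
  ⊖-homo (suc m) zero    = sym (trans (+-congˡ -0#≈0#) (+-identityʳ _))
  ⊖-homo (suc m) (suc n) = begin
    ⟦ suc m ℤ.⊖ suc n ⟧ℤ                ≈⟨ reflℤ (ℤₚ.[1+m]⊖[1+n]≡m⊖n m n) ⟩
    ⟦ m ℤ.⊖ n ⟧ℤ                        ≈⟨ ⊖-homo m n ⟩
    m · 1# - n · 1#                     ≈⟨ cancel-suc _ _ ⟩
    (1# + m · 1#) - (1# + n · 1#)       ≈⟨ +-cong (1+× m 1#) (-‿cong (1+× n 1#)) ⟨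
    suc m · 1# - suc n · 1#             ∎

  neg-homo : ∀ i → ⟦ ℤ.- i ⟧ℤ ≈ - ⟦ i ⟧ℤ
  neg-homo (+ zero)  = sym -0#≈0#
  neg-homo (+ suc n) = refl
  neg-homo -[1+ n ]  = sym (-‿involutive _)

  +-homo : ∀ i j → ⟦ i ℤ.+ j ⟧ℤ ≈ ⟦ i ⟧ℤ + ⟦ j ⟧ℤ
  +-homo (+ m) (+ n)       = ×-homo-+ 1# m n
  +-homo (+ m) -[1+ n ]    = ⊖-homo m (suc n)
  +-homo -[1+ m ] (+ n)    = trans (⊖-homo n (suc m)) (+-comm _ _)
  +-homo -[1+ m ] -[1+ n ] = begin
    - (suc (suc (m ℕ.+ n)) · 1#)       ≡⟨ ≡.cong (λ k → - (suc k · 1#)) (ℕₚ.+-suc m n) ⟨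
    - ((suc m ℕ.+ suc n) · 1#)         ≈⟨ -‿cong (×-homo-+ 1# (suc m) (suc n)) ⟩
    - (suc m · 1# + suc n · 1#)        ≈⟨ ⁻¹-∙-comm _ _ ⟨
    - (suc m · 1#) - (suc n · 1#)      ∎

  *-homo : ∀ i j → ⟦ i ℤ.* j ⟧ℤ ≈ ⟦ i ⟧ℤ * ⟦ j ⟧ℤ
  *-homo (+ m) (+ n)       = trans (reflℤ (ℤₚ.+◃n≡+n (m ℕ.* n))) (×1-homo-* m n)
  *-homo (+ m) -[1+ n ]    = begin
    ⟦ Sign.- ℤ.◃ (m ℕ.* suc n) ⟧ℤ    ≈⟨ reflℤ (ℤₚ.-◃n≡-n (m ℕ.* suc n)) ⟩
    ⟦ ℤ.- (+ (m ℕ.* suc n)) ⟧ℤ       ≈⟨ neg-homo (+ (m ℕ.* suc n)) ⟩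
    - ((m ℕ.* suc n) · 1#)           ≈⟨ -‿cong (×1-homo-* m (suc n)) ⟩
    - (m · 1# * (suc n · 1#))        ≈⟨ -‿distribʳ-* _ _ ⟩
    m · 1# * - (suc n · 1#)          ∎
  *-homo -[1+ m ] (+ n)    = begin
    ⟦ Sign.- ℤ.◃ (suc m ℕ.* n) ⟧ℤ    ≈⟨ reflℤ (ℤₚ.-◃n≡-n (suc m ℕ.* n)) ⟩
    ⟦ ℤ.- (+ (suc m ℕ.* n)) ⟧ℤ       ≈⟨ neg-homo (+ (suc m ℕ.* n)) ⟩
    - ((suc m ℕ.* n) · 1#)           ≈⟨ -‿cong (×1-homo-* (suc m) n) ⟩
    - (suc m · 1# * (n · 1#))        ≈⟨ -‿distribˡ-* _ _ ⟩
    - (suc m · 1#) * (n · 1#)        ∎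
  *-homo -[1+ m ] -[1+ n ] = begin
    (suc m ℕ.* suc n) · 1#               ≈⟨ ×1-homo-* (suc m) (suc n) ⟩
    suc m · 1# * (suc n · 1#)            ≈⟨ -‿involutive _ ⟨
    - (- (suc m · 1# * (suc n · 1#)))    ≈⟨ -‿cong (-‿distribˡ-* _ _) ⟩
    - (- (suc m · 1#) * (suc n · 1#))    ≈⟨ -‿distribʳ-* _ _ ⟩
    - (suc m · 1#) * - (suc n · 1#)      ∎

  morphism : ℤ.+-*-rawRing -Raw-AlmostCommutative⟶ fromCommutativeRing R
  morphism = record
    { ⟦_⟧ = ⟦_⟧ℤ ; +-homo = +-homo ; *-homo = *-homo
    ; -‿homo = neg-homo ; 0-homo = refl ; 1-homo = refl }

  -- Cancellation inside the solver relies on comparing coefficients; integers can be compared,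
  -- elements of `Carrier` in general cannot.
  coeff≟ : ∀ i j → Maybe (⟦ i ⟧ℤ ≈ ⟦ j ⟧ℤ)
  coeff≟ i j with i ℤ.≟ j
  ... | yes i≡j = just (reflℤ i≡j)
  ... | no  _   = nothing

  open import Algebra.Solver.Ring ℤ.+-*-rawRing (fromCommutativeRing R) morphism coeff≟ public
    using (solve; _:=_; _:+_; _:*_; _:-_; :-_; con)

-- Alternating forms, determinants and Cramer's rule.

module AlternatingForms {c ℓ : Level} (R : CommutativeRing c ℓ) (J : Set) where
  open CommutativeRing R hiding (zero)
  open IntegerCoefficients R
  open import Algebra.Properties.Semiring.Sum semiring
  open import Algebra.Properties.CommutativeMonoid.Sum *-commutativeMonoid
    using () renaming (sum to product)
  open import Relation.Binary.Reasoning.Setoid setoid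

  Row : Set c
  Row = J → Carrier

  Form : ℕ → Set c
  Form n = (Fin n → Row) → Carrier

  infix 4 _≐_
  _≐_ : ∀ {n} → (Fin n → Row) → (Fin n → Row) → Set ℓ
  X ≐ Y = ∀ i j → X i j ≈ Y i j

  Congruent : ∀ {n} → Form n → Set (c ⊔ ℓ)
  Congruent f = ∀ {X Y} → X ≐ Y → f X ≈ f Y

  axpy : Carrier → Row → Row → Row
  axpy a u v j = a * u j + v j

  comb : ∀ {n} → (Fin n → Carrier) → (Fin n → Row) → Row
  comb {n} a B j = ∑[ k < n ] (a k * B k j)

  Kills : ∀ n → Row → Form n → Set (c ⊔ ℓ)
  Kills zero    u g = Lift (c ⊔ ℓ) ⊤
  Kills (suc n) u g = ∀ X → g (u ∷ X) ≈ 0#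

  -- Alternation is only required of adjacent rows, at every depth; this suffices because
  -- adjacent transpositions already force a sign change.
  record AlternatingHead (n : ℕ) (f : Form (suc n)) (Rest : Form n → Set (c ⊔ ℓ)) : Set (c ⊔ ℓ) where
    field
      congruent : Congruent f
      linear    : ∀ a u v X → f (axpy a u v ∷ X) ≈ a * f (u ∷ X) + f (v ∷ X)
      rest      : ∀ u → Rest (λ X → f (u ∷ X))
      repeated  : ∀ u → Kills n u (λ X → f (u ∷ X))
  open AlternatingHead

  -- Congruence is part of the data because families of rows are functions: without extensionality
  -- even two empty families are not identified.
  Alternating : ∀ n → Form n → Set (c ⊔ ℓ)
  Alternating zero    f = Congruent f
  Alternating (suc n) f = AlternatingHead n f (Alternating n)

  ∷-cong : ∀ {n u v} {X Y : Fin n → Row} → (∀ j → u j ≈ v j) → X ≐ Y → (u ∷ X) ≐ (v ∷ Y)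
  ∷-cong u≈v X≐Y zero    = u≈v
  ∷-cong u≈v X≐Y (suc i) = X≐Y i

  ∷-congʳ : ∀ {n} u {X Y : Fin n → Row} → X ≐ Y → (u ∷ X) ≐ (u ∷ Y)
  ∷-congʳ u = ∷-cong (λ _ → refl)

  ∷-η : ∀ {n} (X : Fin (suc n) → Row) → X ≐ (X zero ∷ X ∘ suc)
  ∷-η X zero    j = refl
  ∷-η X (suc i) j = refl

  alternating-congruent : ∀ n {f} → Alternating n f → Congruent f
  alternating-congruent zero    F = F
  alternating-congruent (suc n) F = congruent F

  -- A zero row can be written as `- 1# * u + u`, and `linear` then gives a value minus itself.
  linear-zero : ∀ {n f} → Alternating (suc n) f → ∀ u X → (∀ j → u j ≈ 0#) → f (u ∷ X) ≈ 0#
  linear-zero {f = f} F u X u≈0 = begin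
    f (u ∷ X)                            ≈⟨ congruent F (∷-cong eq (λ _ _ → refl)) ⟩
    f (axpy (- 1#) u u ∷ X)              ≈⟨ linear F _ _ _ _ ⟩
    - 1# * f (u ∷ X) + f (u ∷ X)         ≈⟨ solve 1 (λ x → :- con (+ 1) :* x :+ x := con (+ 0)) refl _ ⟩
    0#                                   ∎
    where
    eq : ∀ j → u j ≈ - 1# * u j + u j
    eq j = trans (u≈0 j) (solve 1 (λ x → con (+ 0) := :- con (+ 1) :* x :+ x) refl (u j))

  linear-comb : ∀ {n f} → Alternating (suc n) f → ∀ {m} (a : Fin m → Carrier) B X →
                f (comb a B ∷ X) ≈ ∑[ k < m ] (a k * f (B k ∷ X))
  linear-comb F {zero}  a B X = linear-zero F _ X (λ _ → refl)
  linear-comb F {suc m} a B X =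
    trans (linear F (a zero) (B zero) (comb (a ∘ suc) (B ∘ suc)) X)
          (+-congˡ (linear-comb F (a ∘ suc) (B ∘ suc) X))

  -- Polarisation: `f (w ∷ w ∷ X)` vanishes for `w` the sum of `u` and `v`, and of its four terms
  -- the two with a repeated row vanish as well.
  swap : ∀ {n f} → Alternating (suc (suc n)) f → ∀ u v X → f (u ∷ v ∷ X) ≈ - f (v ∷ u ∷ X)
  swap {f = f} F u v X = begin
    f (u ∷ v ∷ X)
      ≈⟨ solve 2 (λ x y → x := (con (+ 1) :* (con (+ 1) :* con (+ 0) :+ x)
                                  :+ (con (+ 1) :* y :+ con (+ 0))) :- y) refl _ _ ⟩
    (1# * (1# * 0# + f (u ∷ v ∷ X)) + (1# * f (v ∷ u ∷ X) + 0#)) - f (v ∷ u ∷ X)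
      ≈⟨ +-congʳ expand ⟨
    f (w ∷ w ∷ X) - f (v ∷ u ∷ X)
      ≈⟨ +-congʳ (repeated F w X) ⟩
    0# - f (v ∷ u ∷ X)
      ≈⟨ +-identityˡ _ ⟩
    - f (v ∷ u ∷ X) ∎
    where
    w = axpy 1# u v
    expand : f (w ∷ w ∷ X) ≈ 1# * (1# * 0# + f (u ∷ v ∷ X)) + (1# * f (v ∷ u ∷ X) + 0#)
    expand = trans (linear F 1# u v (w ∷ X)) (+-cong
      (*-congˡ (trans (linear (rest F u) 1# u v X) (+-congʳ (*-congˡ (repeated F u X)))))
      (trans (linear (rest F v) 1# u v X) (+-congˡ (repeated F v X))))

  -- Each swap carries `u` past one row, into the form with that row fixed, until the two copies are
  -- adjacent.
  equal-rows : ∀ {n f} → Alternating (suc n) f → ∀ u X i → (∀ j → X i j ≈ u j) → f (u ∷ X) ≈ 0#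
  equal-rows {suc n} F u X zero Xᵢ≈u =
    trans (congruent F (∷-congʳ u λ { zero → Xᵢ≈u ; (suc _) _ → refl })) (repeated F u (X ∘ suc))
  equal-rows {suc n} {f} F u X (suc i) Xᵢ≈u = begin
    f (u ∷ X)                      ≈⟨ congruent F (∷-congʳ u (∷-η X)) ⟩
    f (u ∷ X zero ∷ X ∘ suc)       ≈⟨ swap F _ _ _ ⟩
    - f (X zero ∷ u ∷ X ∘ suc)     ≈⟨ -‿cong (equal-rows (rest F (X zero)) u (X ∘ suc) i Xᵢ≈u) ⟩
    - 0#                           ≈⟨ solve 0 (:- con (+ 0) := con (+ 0)) refl ⟩
    0#                             ∎

  -- The hypothesis holds for `f = g (u ∷_)` with `g` alternating. Unlike that shape, it passes to
  -- `f (X zero ∷_)`, which is what the induction on rows needs.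
  drop-multiples : ∀ {n f} → Alternating n f → ∀ u → (∀ Y i → (∀ j → Y i j ≈ u j) → f Y ≈ 0#) →
                   ∀ (a : Fin n → Carrier) X → f (λ i → axpy (a i) u (X i)) ≈ f X
  drop-multiples {zero}  F u kill a X = F (λ ())
  drop-multiples {suc n} {f} F u kill a X = begin
    f (λ i → axpy (a i) u (X i))                ≈⟨ congruent F (∷-η _) ⟩
    f (axpy (a zero) u (X zero) ∷ Y)            ≈⟨ linear F _ _ _ _ ⟩
    a zero * f (u ∷ Y) + f (X zero ∷ Y)         ≈⟨ +-cong (*-congˡ (kill (u ∷ Y) zero (λ _ → refl)))
      (drop-multiples (rest F (X zero)) u (λ Z i → kill (X zero ∷ Z) (suc i)) (a ∘ suc) (X ∘ suc)) ⟩
    a zero * 0# + f (X zero ∷ X ∘ suc)          ≈⟨ trans (+-congʳ (zeroʳ _)) (+-identityˡ _) ⟩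
    f (X zero ∷ X ∘ suc)                        ≈⟨ congruent F (∷-η X) ⟨
    f X                                         ∎
    where Y = λ i → axpy (a (suc i)) u (X (suc i))

  sgn : ∀ {n} → Fin n → Carrier
  sgn zero    = 1#
  sgn (suc k) = - sgn k

  sgn² : ∀ {n} (k : Fin n) → sgn k * sgn k ≈ 1#
  sgn² zero    = *-identityˡ 1#
  sgn² (suc k) = trans (solve 1 (λ x → :- x :* :- x := x :* x) refl _) (sgn² k)

  move-to-front : ∀ {n f} → Alternating (suc n) f → ∀ B k →
                  f (B k ∷ removeAt B k) ≈ sgn k * f B
  move-to-front F B zero = trans (congruent F λ { zero _ → refl ; (suc _) _ → refl }) (sym (*-identityˡ _))
  move-to-front {suc n} {f} F B (suc k) = begin
    f (B (suc k) ∷ removeAt B (suc k))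
      ≈⟨ congruent F (∷-congʳ _ (∷-η _)) ⟩
    f (B (suc k) ∷ B zero ∷ removeAt (B ∘ suc) k)
      ≈⟨ swap F _ _ _ ⟩
    - f (B zero ∷ B (suc k) ∷ removeAt (B ∘ suc) k)
      ≈⟨ -‿cong (move-to-front (rest F (B zero)) (B ∘ suc) k) ⟩
    - (sgn k * f (B zero ∷ B ∘ suc))
      ≈⟨ -‿cong (*-congˡ (congruent F (∷-η B))) ⟨
    - (sgn k * f B)
      ≈⟨ solve 2 (λ x y → :- (x :* y) := :- x :* y) refl _ _ ⟩
    - sgn k * f B ∎

  -- Laplace expansion along row 0, arranged as the scalar that `det-mult` produces.
  det : ∀ n → (Fin n → Fin n → Carrier) → Carrier
  det zero    A = 1#
  det (suc n) A = ∑[ k ≤ n ] (A zero k * (det n (λ i → removeAt (A (suc i)) k) * sgn k))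

  -- Expanding row 0 leaves the terms f (B k ∷ …); there B k can be dropped from all other rows,
  -- and f (B k ∷_) is an alternating form in the remaining rows of B.
  det-mult : ∀ {n f} → Alternating n f → ∀ A B → f (λ i → comb (A i) B) ≈ det n A * f B
  det-mult {zero}  F A B = trans (F (λ ())) (sym (*-identityˡ _))
  det-mult {suc n} {f} F A B = begin
    f (λ i → comb (A i) B)
      ≈⟨ congruent F (∷-η _) ⟩
    f (comb (A zero) B ∷ AB)
      ≈⟨ linear-comb F (A zero) B AB ⟩
    ∑[ k ≤ n ] (A zero k * f (B k ∷ AB))
      ≈⟨ sum-cong-≋ {suc n} summand ⟩
    ∑[ k ≤ n ] (A zero k * (det n (minor k) * sgn k) * f B)
      ≈⟨ *-distribʳ-sum {suc n} (f B) (λ k → A zero k * (det n (minor k) * sgn k)) ⟨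
    det (suc n) A * f B ∎
    where
    AB = λ i → comb (A (suc i)) B
    minor = λ k i → removeAt (A (suc i)) k
    summand : ∀ k → A zero k * f (B k ∷ AB) ≈ A zero k * (det n (minor k) * sgn k) * f B
    summand k = begin
      A zero k * f (B k ∷ AB)
        ≈⟨ *-congˡ (congruent F (∷-congʳ (B k) (λ i j → sum-remove {i = k} (λ l → A (suc i) l * B l j)))) ⟩
      A zero k * f (B k ∷ λ i → axpy (A (suc i) k) (B k) (comb (minor k i) (removeAt B k)))
        ≈⟨ *-congˡ (drop-multiples (rest F (B k)) (B k) (equal-rows F (B k)) _ _) ⟩
      A zero k * f (B k ∷ λ i → comb (minor k i) (removeAt B k))
        ≈⟨ *-congˡ (det-mult (rest F (B k)) (minor k) (removeAt B k)) ⟩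
      A zero k * (det n (minor k) * f (B k ∷ removeAt B k))
        ≈⟨ *-congˡ (*-congˡ (move-to-front F B k)) ⟩
      A zero k * (det n (minor k) * (sgn k * f B))
        ≈⟨ solve 4 (λ x y z w → x :* (y :* (z :* w)) := x :* (y :* z) :* w) refl _ _ _ _ ⟩
      A zero k * (det n (minor k) * sgn k) * f B ∎

  -- After expansion of the front row, every term except the `k`-th repeats a row of `removeAt B k`.
  -- The combination stands in front instead of in place `k`, which costs the factor `sgn k`.
  cramer : ∀ {n f} → Alternating (suc n) f → ∀ a B k →
           f (comb a B ∷ removeAt B k) ≈ a k * (sgn k * f B)
  cramer {n} {f} F a B k = begin
    f (comb a B ∷ removeAt B k)
      ≈⟨ linear-comb F a B (removeAt B k) ⟩
    ∑[ l ≤ n ] (a l * f (B l ∷ removeAt B k))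
      ≈⟨ sum-remove {i = k} (λ l → a l * f (B l ∷ removeAt B k)) ⟩
    a k * f (B k ∷ removeAt B k) + ∑[ l < n ] (a (punchIn k l) * f (B (punchIn k l) ∷ removeAt B k))
      ≈⟨ +-cong (*-congˡ (move-to-front F B k))
                (trans (sum-cong-≋ {n} (λ l → trans (*-congˡ (equal-rows F _ _ l (λ _ → refl))) (zeroʳ _)))
                       (sum-replicate-zero n)) ⟩
    a k * (sgn k * f B) + 0#
      ≈⟨ +-identityʳ _ ⟩
    a k * (sgn k * f B) ∎

  -- The exterior product of the j-th coordinate with g:
  -- ∑ᵢ (−1)ⁱ X i j · g (X without row i).
  wedge : J → ∀ n → Form n → Form (suc n)
  wedge j zero    g X = X zero j * g (X ∘ suc)
  wedge j (suc n) g X = X zero j * g (X ∘ suc) - wedge j n (λ Y → g (X zero ∷ Y)) (X ∘ suc)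

  wedge-cong : ∀ j n {g h} → (∀ {X Y} → X ≐ Y → g X ≈ h Y) → ∀ {X Y} → X ≐ Y →
               wedge j n g X ≈ wedge j n h Y
  wedge-cong j zero    g≈h X≐Y = *-cong (X≐Y zero j) (g≈h (X≐Y ∘ suc))
  wedge-cong j (suc n) g≈h X≐Y = +-cong
    (*-cong (X≐Y zero j) (g≈h (X≐Y ∘ suc)))
    (-‿cong (wedge-cong j n (λ X≐Y′ → g≈h (∷-cong (X≐Y zero) X≐Y′)) (X≐Y ∘ suc)))

  wedge-linear : ∀ j n a {f g h} → (∀ X → f X ≈ a * g X + h X) → ∀ X →
                 wedge j n f X ≈ a * wedge j n g X + wedge j n h X
  wedge-linear j zero    a f≈ X = trans (*-congˡ (f≈ _))
    (solve 4 (λ x a g h → x :* (a :* g :+ h) := a :* (x :* g) :+ x :* h) refl _ _ _ _)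
  wedge-linear j (suc n) a f≈ X = trans
    (+-cong (*-congˡ (f≈ _)) (-‿cong (wedge-linear j n a (λ Y → f≈ (X zero ∷ Y)) (X ∘ suc))))
    (solve 6 (λ x a g h g′ h′ → x :* (a :* g :+ h) :- (a :* g′ :+ h′)
                             := a :* (x :* g :- g′) :+ (x :* h :- h′)) refl _ _ _ _ _ _)

  x-0≈x : ∀ x → x - 0# ≈ x
  x-0≈x = solve 1 (λ x → x :- con (+ 0) := x) refl

  wedge-zero : ∀ j n {g} → (∀ X → g X ≈ 0#) → ∀ X → wedge j n g X ≈ 0#
  wedge-zero j zero    g≈0 X = trans (*-congˡ (g≈0 _)) (zeroʳ _)
  wedge-zero j (suc n) g≈0 X = trans
    (+-cong (trans (*-congˡ (g≈0 _)) (zeroʳ _)) (-‿cong (wedge-zero j n (λ Y → g≈0 _) _)))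
    (x-0≈x 0#)

  -- The shape `a * f - g` is that of a wedge whose first row is fixed, as met in the `rest` field
  -- of `wedge-alternating`.
  alternating-sub : ∀ n a {f g} → Alternating n f → Alternating n g →
                    Alternating n (λ X → a * f X - g X)
  alternating-sub zero    a F G = λ X≐Y → +-cong (*-congˡ (F X≐Y)) (-‿cong (G X≐Y))
  alternating-sub (suc n) a {f} {g} F G = record
    { congruent = λ X≐Y → +-cong (*-congˡ (congruent F X≐Y)) (-‿cong (congruent G X≐Y))
    ; linear    = λ b u v X → trans
        (+-cong (*-congˡ (linear F b u v X)) (-‿cong (linear G b u v X)))
        (solve 6 (λ a b f g f′ g′ → a :* (b :* f :+ f′) :- (b :* g :+ g′)
                                 := b :* (a :* f :- g) :+ (a :* f′ :- g′)) refl _ _ _ _ _ _)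
    ; rest      = λ u → alternating-sub n a (rest F u) (rest G u)
    ; repeated  = kills n {f} {g} (repeated F) (repeated G)
    }
    where
    kills : ∀ n {f g : Form (suc n)} →
            (∀ u → Kills n u (λ X → f (u ∷ X))) → (∀ u → Kills n u (λ X → g (u ∷ X))) →
            ∀ u → Kills n u (λ X → a * f (u ∷ X) - g (u ∷ X))
    kills zero    _ _ _   = lift tt
    kills (suc n) F G u X = trans (+-cong (trans (*-congˡ (F u X)) (zeroʳ _)) (-‿cong (G u X))) (x-0≈x 0#)

  -- The terms that omit one of the two copies of `u` cancel; every other term keeps both copies and
  -- is killed by `g`.
  wedge-repeated : ∀ j n {g} → Alternating n g → ∀ u → Kills n u (λ X → wedge j n g (u ∷ X))
  wedge-repeated j zero          G u   = lift tt
  wedge-repeated j (suc zero)    G u X = -‿inverseʳ _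
  wedge-repeated j (suc (suc n)) G u X = trans
    (solve 2 (λ x y → x :- (x :- y) := y) refl _ _)
    (wedge-zero j n (repeated G u) X)

  wedge-alternating : ∀ j n {g} → Alternating n g → Alternating (suc n) (wedge j n g)
  wedge-alternating j zero G = record
    { congruent = wedge-cong j zero G
    ; linear    = λ a u v X → solve 4 (λ a u v g → (a :* u :+ v) :* g := a :* (u :* g) :+ v :* g) refl _ _ _ _
    ; rest      = λ u X≐Y → *-congˡ (G X≐Y)
    ; repeated  = λ u → lift tt
    }
  wedge-alternating j (suc n) G = record
    { congruent = wedge-cong j (suc n) (congruent G)
    ; linear    = λ a u v X → trans
        (+-congˡ (-‿cong (wedge-linear j n a (linear G a u v) X)))
        (solve 6 (λ a u v g w w′ → (a :* u :+ v) :* g :- (a :* w :+ w′)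
                                := a :* (u :* g :- w) :+ (v :* g :- w′)) refl _ _ _ _ _ _)
    ; rest      = λ u → alternating-sub (suc n) (u j) G (wedge-alternating j n (rest G u))
    ; repeated  = wedge-repeated j (suc n) G
    }

  -- The minor on the columns `js`, expanded column by column. As an iterated wedge of coordinates
  -- it is alternating in the rows by induction, whereas the row expansion `det` is suited to
  -- products of matrices.
  volume : ∀ n → (Fin n → J) → Form n
  volume zero    js X = 1#
  volume (suc n) js   = wedge (js zero) n (volume n (js ∘ suc))

  volume-alternating : ∀ n js → Alternating n (volume n js)
  volume-alternating zero    js = λ _ → refl
  volume-alternating (suc n) js = wedge-alternating (js zero) n (volume-alternating n (js ∘ suc))

  wedge-vanishes : ∀ j n g X → (∀ i → X i j ≈ 0#) → wedge j n g X ≈ 0#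
  wedge-vanishes j zero    g X X≈0 = trans (*-congʳ (X≈0 zero)) (zeroˡ _)
  wedge-vanishes j (suc n) g X X≈0 = trans
    (+-cong (trans (*-congʳ (X≈0 zero)) (zeroˡ _)) (-‿cong (wedge-vanishes j n _ _ (X≈0 ∘ suc))))
    (x-0≈x 0#)

  -- Column `js zero` is zero below row 0, so its expansion keeps only the leading term. General
  -- `js` lets the induction drop a column while the index set `J` stays fixed.
  volume-diagonal : ∀ n js X → (∀ i k → i ≢ k → X i (js k) ≈ 0#) →
                    volume n js X ≈ product (λ i → X i (js i))
  volume-diagonal zero          js X X≈0 = refl
  volume-diagonal (suc zero)    js X X≈0 = refl
  volume-diagonal (suc (suc n)) js X X≈0 = trans
    (+-cong (*-congˡ (volume-diagonal (suc n) (js ∘ suc) (X ∘ suc) (λ i k i≢k → X≈0 _ _ (i≢k ∘ suc-injective))))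
            (-‿cong (wedge-vanishes (js zero) n _ _ (λ i → X≈0 (suc i) zero (λ ())))))
    (x-0≈x _)

  module _ {s} (S : Carrier → Set s) (S-1 : S 1#)
           (S-+ : ∀ {x y} → S x → S y → S (x + y)) (S-* : ∀ {x y} → S x → S y → S (x * y))
           (S-- : ∀ {x} → S x → S (- x)) where

    wedge-closed : ∀ j n g → (∀ X → (∀ i k → S (X i k)) → S (g X)) →
                   ∀ X → (∀ i k → S (X i k)) → S (wedge j n g X)
    wedge-closed j zero    g Sg X SX = S-* (SX zero j) (Sg _ (SX ∘ suc))
    wedge-closed j (suc n) g Sg X SX = S-+ (S-* (SX zero j) (Sg _ (SX ∘ suc)))
      (S-- (wedge-closed j n _ (λ Y SY → Sg _ λ { zero → SX zero ; (suc i) → SY i }) _ (SX ∘ suc)))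

    -- A determinant is a ring expression in its entries; this puts the Hankel determinants into the
    -- field generated by the power sums.
    volume-closed : ∀ n js X → (∀ i k → S (X i k)) → S (volume n js X)
    volume-closed zero    js X SX = S-1
    volume-closed (suc n) js X SX = wedge-closed (js zero) n _ (volume-closed n (js ∘ suc)) X SX

module Subrings {r ℓ : Level} (R : CommutativeRing r ℓ) where
  open CommutativeRing R hiding (zero)
  open IntegerCoefficients R
  open import Algebra.Properties.Semiring.Mult semiring using () renaming (_×_ to _·_)

  record IsSubring {s} (S : Carrier → Set s) : Set (r ⊔ ℓ ⊔ s) where
    field
      resp     : ∀ {x y} → x ≈ y → S x → S y
      1-closed : S 1#
      +-closed : ∀ {x y} → S x → S y → S (x + y)
      *-closed : ∀ {x y} → S x → S y → S (x * y)
      neg-closed : ∀ {x} → S x → S (- x)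

    0-closed : S 0#
    0-closed = resp (-‿inverseʳ 1#) (+-closed 1-closed (neg-closed 1-closed))

    ×-closed : ∀ k {x} → S x → S (k · x)
    ×-closed zero    Sx = 0-closed
    ×-closed (suc k) Sx = +-closed Sx (×-closed k Sx)

-- Newton's identities, Vieta's formulas and evaluation at the roots.

module SymmetricFunctions {ρ ℓ : Level} (R : CommutativeRing ρ ℓ) where
  open CommutativeRing R hiding (zero)
  open IntegerCoefficients R
  open Subrings R
  open import Algebra.Properties.Semiring.Sum semiring
  open import Algebra.Properties.Semiring.Exp semiring using (_^_; ^-homo-*)
  open import Algebra.Properties.Semiring.Mult semiring using (×-congʳ; ×-comm-*) renaming (_×_ to _·_)
  open import Algebra.Properties.CommutativeMonoid.Mult +-commutativeMonoid using (×-distrib-+)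
  open import Algebra.Properties.CommutativeMonoid.Sum *-commutativeMonoid
    using () renaming
    ( sum to product; sum-remove to product-remove; sum-cong-≋ to product-cong
    ; sum-replicate-zero to product-replicate-one )
  open import Relation.Binary.Reasoning.Setoid setoid

  -- The recursion of `esym` on values in a ring: dropping a variable becomes `xs ∘ suc`, and
  -- `shift` disappears.
  elem : ∀ m → (Fin m → Carrier) → ℕ → Carrier
  elem m       xs zero    = 1#
  elem zero    xs (suc k) = 0#
  elem (suc m) xs (suc k) = elem m (xs ∘ suc) (suc k) + xs zero * elem m (xs ∘ suc) k

  elem-vanishes : ∀ m xs k → m ℕ.< k → elem m xs k ≈ 0#
  elem-vanishes zero    xs (suc k) _         = refl
  elem-vanishes (suc m) xs (suc k) (s≤s m<k) = begin
    elem m (xs ∘ suc) (suc k) + xs zero * elem m (xs ∘ suc) k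
      ≈⟨ +-cong (elem-vanishes m _ (suc k) (ℕₚ.m<n⇒m<1+n m<k)) (*-congˡ (elem-vanishes m _ k m<k)) ⟩
    0# + xs zero * 0#
      ≈⟨ solve 1 (λ x → con (+ 0) :+ x :* con (+ 0) := con (+ 0)) refl _ ⟩
    0# ∎

  power : ∀ m → (Fin m → Carrier) → ℕ → Carrier
  power m xs k = ∑[ i < m ] (xs i ^ k)

  -- ∑_{i<k} (−1)ⁱ q i · e (k − 1 − i).
  alternatingConv : (ℕ → Carrier) → (ℕ → Carrier) → ℕ → Carrier
  alternatingConv q e zero    = 0#
  alternatingConv q e (suc k) = q 0 * e k - alternatingConv (q ∘ suc) e k

  conv-zeroˡ : ∀ {q} e → (∀ i → q i ≈ 0#) → ∀ k → alternatingConv q e k ≈ 0#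
  conv-zeroˡ e q≈0 zero    = refl
  conv-zeroˡ e q≈0 (suc k) = trans
    (+-cong (*-congʳ (q≈0 0)) (-‿cong (conv-zeroˡ e (q≈0 ∘ suc) k)))
    (solve 1 (λ x → con (+ 0) :* x :- con (+ 0) := con (+ 0)) refl _)

  conv-+ : ∀ q q′ e k → alternatingConv (λ i → q i + q′ i) e k ≈
                        alternatingConv q e k + alternatingConv q′ e k
  conv-+ q q′ e zero    = sym (+-identityˡ _)
  conv-+ q q′ e (suc k) = trans
    (+-congˡ (-‿cong (conv-+ (q ∘ suc) (q′ ∘ suc) e k)))
    (solve 5 (λ q q′ e s t → (q :+ q′) :* e :- (s :+ t) := (q :* e :- s) :+ (q′ :* e :- t)) refl _ _ _ _ _)

  conv-* : ∀ a q e k → alternatingConv (λ i → a * q i) e k ≈ a * alternatingConv q e k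
  conv-* a q e zero    = sym (zeroʳ a)
  conv-* a q e (suc k) = trans
    (+-congˡ (-‿cong (conv-* a (q ∘ suc) e k)))
    (solve 4 (λ a q e s → a :* q :* e :- a :* s := a :* (q :* e :- s)) refl _ _ _ _)

  -- On generating series, a new root a multiplies that of `elem` by 1 + a t, and the convolution is
  -- linear in its second argument.
  conv-new-root : ∀ m xs q k →
    alternatingConv q (elem (suc m) xs) (suc k) ≈
    alternatingConv q (elem m (xs ∘ suc)) (suc k) + xs zero * alternatingConv q (elem m (xs ∘ suc)) k
  conv-new-root m xs q zero    = sym (trans (+-congˡ (zeroʳ _)) (+-identityʳ _))
  conv-new-root m xs q (suc k) = trans
    (+-congˡ (-‿cong (conv-new-root m xs (q ∘ suc) k)))
    (solve 6 (λ q e₁ e₀ a s₁ s₀ → q :* (e₁ :+ a :* e₀) :- (s₁ :+ a :* s₀)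
                               := (q :* e₁ :- s₁) :+ a :* (q :* e₀ :- s₀)) refl _ _ _ _ _ _)

  -- The signed powers of a = `xs zero` sum to a / (1 + a t), which cancels the factor 1 + a t
  -- contributed by the root a.
  conv-geometric : ∀ m xs k →
    alternatingConv (λ i → xs zero ^ suc i) (elem (suc m) xs) (suc k) ≈ xs zero * elem m (xs ∘ suc) k
  conv-geometric m xs zero    = solve 1 (λ a → a :* con (+ 1) :* con (+ 1) :- con (+ 0) := a :* con (+ 1)) refl _
  conv-geometric m xs (suc k) = trans
    (+-congˡ (-‿cong (trans
      (conv-* (xs zero) (λ i → xs zero ^ suc i) _ (suc k)) (*-congˡ (conv-geometric m xs k)))))
    (solve 3 (λ a e₁ e₀ → a :* con (+ 1) :* (e₁ :+ a :* e₀) :- a :* (a :* e₀) := a :* e₁) refl _ _ _)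

  -- Induction on the number of variables. Of the k + 1 copies of a e_k, one comes from the powers
  -- of the new variable a (`conv-geometric`), and the other k are the old identity times a
  -- (`conv-new-root`).
  newton : ∀ m xs k → k · elem m xs k ≈ alternatingConv (λ i → power m xs (suc i)) (elem m xs) k
  newton m       xs zero    = refl
  newton zero    xs (suc k) = begin
    suc k · 0#                                           ≈⟨ ×-congʳ (suc k) (zeroˡ 0#) ⟨
    suc k · (0# * 0#)                                    ≈⟨ ×-comm-* (suc k) 0# 0# ⟨
    0# * (suc k · 0#)                                    ≈⟨ zeroˡ _ ⟩
    0#                                                   ≈⟨ conv-zeroˡ _ (λ _ → refl) (suc k) ⟨
    alternatingConv (λ i → 0#) (elem zero xs) (suc k)    ∎
  newton (suc m) xs (suc k) = begin
    suc k · (e (suc k) + a * e k)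
      ≈⟨ ×-distrib-+ _ _ (suc k) ⟩
    suc k · e (suc k) + (a * e k + k · (a * e k))
      ≈⟨ +-cong (newton m _ (suc k)) (+-congˡ (trans (sym (×-comm-* k a (e k))) (*-congˡ (newton m _ k)))) ⟩
    alternatingConv q e (suc k) + (a * e k + a * alternatingConv q e k)
      ≈⟨ solve 3 (λ s x t → s :+ (x :+ t) := x :+ (s :+ t)) refl _ _ _ ⟩
    a * e k + (alternatingConv q e (suc k) + a * alternatingConv q e k)
      ≈⟨ +-cong (conv-geometric m xs k) (conv-new-root m xs q k) ⟨
    alternatingConv (λ i → a ^ suc i) e′ (suc k) + alternatingConv q e′ (suc k)
      ≈⟨ conv-+ (λ i → a ^ suc i) q e′ (suc k) ⟨
    alternatingConv (λ i → power (suc m) xs (suc i)) e′ (suc k) ∎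
    where
    a  = xs zero
    e  = elem m (xs ∘ suc)
    e′ = elem (suc m) xs
    q  = λ i → power m (xs ∘ suc) (suc i)

  module _ {s} {S : Carrier → Set s} (isSubring : IsSubring S) where
    open IsSubring isSubring

    -- Stripping the first summand replaces `q` by `q ∘ suc` and flips the sign, until only the term
    -- with `e 0` is left.
    conv-last : ∀ q e k → e 0 ≈ 1# → (∀ i → S (e i)) → (∀ i → i ℕ.< k → S (q i)) →
                S (alternatingConv q e (suc k)) → S (q k)
    conv-last q e zero    e₀≈1 Se Sq Sconv = resp
      (trans (+-congʳ (*-congˡ e₀≈1)) (solve 1 (λ q → q :* con (+ 1) :- con (+ 0) := q) refl _)) Sconv
    conv-last q e (suc k) e₀≈1 Se Sq Sconv = conv-last (q ∘ suc) e k e₀≈1 Se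
      (λ i i<k → Sq (suc i) (s≤s i<k))
      (resp (solve 2 (λ x y → x :- (x :- y) := y) refl _ _)
            (+-closed (*-closed (Sq 0 (s≤s z≤n)) (Se (suc k))) (neg-closed Sconv)))

    power-closed : ∀ m xs → (∀ k → S (elem m xs k)) → ∀ k → S (power m xs (suc k))
    power-closed m xs Se k = below (suc k) k ℕₚ.≤-refl
      where
      p = λ i → power m xs (suc i)
      below : ∀ k i → i ℕ.< k → S (p i)
      below (suc k) i i<1+k with ℕₚ.m<1+n⇒m<n∨m≡n i<1+k
      ... | inj₁ i<k    = below k i i<k
      ... | inj₂ ≡.refl = conv-last p (elem m xs) k refl Se (below k)
                            (resp (newton m xs (suc k)) (×-closed (suc k) (Se (suc k))))

  -- The coefficient of T^j in the product of the T - xs i.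
  coef : ∀ m → (Fin m → Carrier) → ℕ → Carrier
  coef zero    xs zero    = 1#
  coef zero    xs (suc j) = 0#
  coef (suc m) xs zero    = - xs zero * coef m (xs ∘ suc) zero
  coef (suc m) xs (suc j) = - xs zero * coef m (xs ∘ suc) (suc j) + coef m (xs ∘ suc) j

  coef-vanishes : ∀ m xs j → m ℕ.< j → coef m xs j ≈ 0#
  coef-vanishes zero    xs (suc j) _         = refl
  coef-vanishes (suc m) xs (suc j) (s≤s m<j) = begin
    - xs zero * coef m (xs ∘ suc) (suc j) + coef m (xs ∘ suc) j
      ≈⟨ +-cong (*-congˡ (coef-vanishes m _ (suc j) (ℕₚ.m<n⇒m<1+n m<j))) (coef-vanishes m _ j m<j) ⟩
    - xs zero * 0# + 0#
      ≈⟨ solve 1 (λ x → x :* con (+ 0) :+ con (+ 0) := con (+ 0)) refl _ ⟩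
    0# ∎

  sign : ℕ → Carrier
  sign zero    = 1#
  sign (suc k) = - sign k

  sign² : ∀ k → sign k * sign k ≈ 1#
  sign² zero    = *-identityˡ 1#
  sign² (suc k) = trans (solve 1 (λ x → :- x :* :- x := x :* x) refl _) (sign² k)

  -- Vieta's formulas. At both extreme values of `j` one term lies outside the range of degrees and
  -- is removed by `elem-vanishes` or `coef-vanishes`.
  coef-elem : ∀ m xs j k → j ℕ.+ k ≡ m → coef m xs j ≈ sign k * elem m xs k
  coef-elem zero    xs zero    zero    _      = sym (*-identityˡ 1#)
  coef-elem (suc m) xs zero    (suc _) ≡.refl = begin
    - xs zero * coef m (xs ∘ suc) zero
      ≈⟨ *-congˡ (coef-elem m _ zero m ≡.refl) ⟩
    - xs zero * (sign m * elem m (xs ∘ suc) m)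
      ≈⟨ solve 3 (λ a s e → :- a :* (s :* e) := :- s :* (con (+ 0) :+ a :* e)) refl _ _ _ ⟩
    - sign m * (0# + xs zero * elem m (xs ∘ suc) m)
      ≈⟨ *-congˡ (+-congʳ (elem-vanishes m _ (suc m) ℕₚ.≤-refl)) ⟨
    - sign m * (elem m (xs ∘ suc) (suc m) + xs zero * elem m (xs ∘ suc) m) ∎
  coef-elem (suc m) xs (suc j) zero    eq     = begin
    - xs zero * coef m (xs ∘ suc) (suc j) + coef m (xs ∘ suc) j
      ≈⟨ +-cong (*-congˡ (coef-vanishes m _ (suc j) m<1+j)) (coef-elem m _ j zero (ℕₚ.suc-injective eq)) ⟩
    - xs zero * 0# + 1# * 1#
      ≈⟨ solve 1 (λ x → x :* con (+ 0) :+ con (+ 1) :* con (+ 1) := con (+ 1) :* con (+ 1)) refl _ ⟩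
    1# * 1# ∎
    where
    m<1+j : m ℕ.< suc j
    m<1+j = s≤s (ℕₚ.≤-reflexive (≡.trans (≡.sym (ℕₚ.suc-injective eq)) (ℕₚ.+-identityʳ j)))
  coef-elem (suc m) xs (suc j) (suc k) eq     = begin
    - xs zero * coef m (xs ∘ suc) (suc j) + coef m (xs ∘ suc) j
      ≈⟨ +-cong (*-congˡ (coef-elem m _ (suc j) k (≡.trans (≡.sym (ℕₚ.+-suc j k)) (ℕₚ.suc-injective eq))))
                (coef-elem m _ j (suc k) (ℕₚ.suc-injective eq)) ⟩
    - xs zero * (sign k * elem m (xs ∘ suc) k) + - sign k * elem m (xs ∘ suc) (suc k)
      ≈⟨ solve 4 (λ a s e₀ e₁ → :- a :* (s :* e₀) :+ :- s :* e₁ := :- s :* (e₁ :+ a :* e₀)) refl _ _ _ _ ⟩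
    - sign k * (elem m (xs ∘ suc) (suc k) + xs zero * elem m (xs ∘ suc) k) ∎

  horner : ℕ → (ℕ → Carrier) → Carrier → Carrier
  horner zero    c y = 0#
  horner (suc k) c y = c 0 + y * horner k (c ∘ suc) y

  horner-linear : ∀ k a c d y → horner k (λ j → a * c j + d j) y ≈ a * horner k c y + horner k d y
  horner-linear zero    a c d y = solve 1 (λ a → con (+ 0) := a :* con (+ 0) :+ con (+ 0)) refl a
  horner-linear (suc k) a c d y = trans
    (+-congˡ (*-congˡ (horner-linear k a (c ∘ suc) (d ∘ suc) y)))
    (solve 6 (λ a c d y s t → (a :* c :+ d) :+ y :* (a :* s :+ t)
                           := a :* (c :+ y :* s) :+ (d :+ y :* t)) refl _ _ _ _ _ _)

  horner-top : ∀ k c y → horner (suc k) c y ≈ horner k c y + c k * y ^ k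
  horner-top zero    c y = solve 2 (λ c y → c :+ y :* con (+ 0) := con (+ 0) :+ c :* con (+ 1)) refl _ _
  horner-top (suc k) c y = trans
    (+-congˡ (*-congˡ (horner-top k (c ∘ suc) y)))
    (solve 5 (λ c y h d p → c :+ y :* (h :+ d :* p) := (c :+ y :* h) :+ d :* (y :* p)) refl _ _ _ _ _)

  horner-sum : ∀ k c y → ∑[ j < k ] (c (toℕ j) * y ^ toℕ j) ≈ horner k c y
  horner-sum zero    c y = refl
  horner-sum (suc k) c y = +-cong (*-identityʳ _) (begin
    ∑[ j < k ] (c (suc (toℕ j)) * (y * y ^ toℕ j))
      ≈⟨ sum-cong-≋ {k} (λ _ → solve 3 (λ c y p → c :* (y :* p) := y :* (c :* p)) refl _ _ _) ⟩
    ∑[ j < k ] (y * (c (suc (toℕ j)) * y ^ toℕ j))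
      ≈⟨ *-distribˡ-sum {k} y _ ⟨
    y * ∑[ j < k ] (c (suc (toℕ j)) * y ^ toℕ j)
      ≈⟨ *-congˡ (horner-sum k (c ∘ suc) y) ⟩
    y * horner k (c ∘ suc) y ∎)

  horner-coef : ∀ m xs y → horner (suc m) (coef m xs) y ≈ product (λ i → y - xs i)
  horner-coef zero    xs y = solve 1 (λ y → con (+ 1) :+ y :* con (+ 0) := con (+ 1)) refl y
  horner-coef (suc m) xs y = begin
    - a * d 0 + y * horner (suc m) (λ j → - a * d (suc j) + d j) y
      ≈⟨ +-congˡ (*-congˡ (horner-linear (suc m) (- a) (d ∘ suc) d y)) ⟩
    - a * d 0 + y * (- a * horner (suc m) (d ∘ suc) y + horner (suc m) d y)
      ≈⟨ solve 5 (λ a d y s t → :- a :* d :+ y :* (:- a :* s :+ t)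
                             := :- a :* (d :+ y :* s) :+ y :* t) refl _ _ _ _ _ ⟩
    - a * horner (suc (suc m)) d y + y * horner (suc m) d y
      ≈⟨ +-congʳ (*-congˡ (trans (horner-top (suc m) d y) (trans (+-congˡ
           (trans (*-congʳ (coef-vanishes m _ (suc m) ℕₚ.≤-refl)) (zeroˡ _))) (+-identityʳ _)))) ⟩
    - a * horner (suc m) d y + y * horner (suc m) d y
      ≈⟨ solve 3 (λ a y t → :- a :* t :+ y :* t := (y :- a) :* t) refl _ _ _ ⟩
    (y - a) * horner (suc m) d y
      ≈⟨ *-congˡ (horner-coef m (xs ∘ suc) y) ⟩
    (y - a) * product (λ i → y - xs (suc i)) ∎
    where
    a = xs zero
    d = coef m (xs ∘ suc)

  product-vanishes : ∀ {n} (t : Fin n → Carrier) i → t i ≈ 0# → product t ≈ 0#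
  product-vanishes {suc n} t i tᵢ≈0 = trans (product-remove {i = i} t) (trans (*-congʳ tᵢ≈0) (zeroˡ _))

  horner-coef-root : ∀ m xs i → horner (suc m) (coef m xs) (xs i) ≈ 0#
  horner-coef-root m xs i = trans (horner-coef m xs (xs i)) (product-vanishes _ i (-‿inverseʳ _))

  -- Pairing a polynomial with the moments of the weights `u` at the nodes `x` evaluates it at the
  -- nodes. The recurrence and both halves of the diagonalisation are instances.
  combine-moments : ∀ {n} k c (u x : Fin n → Carrier) →
    ∑[ j < k ] (c (toℕ j) * ∑[ a < n ] (u a * x a ^ toℕ j)) ≈ ∑[ a < n ] (u a * horner k c (x a))
  combine-moments {n} k c u x = begin
    ∑[ j < k ] (c (toℕ j) * ∑[ a < n ] (u a * x a ^ toℕ j))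
      ≈⟨ sum-cong-≋ {k} (λ j → *-distribˡ-sum {n} (c (toℕ j)) _) ⟩
    ∑[ j < k ] ∑[ a < n ] (c (toℕ j) * (u a * x a ^ toℕ j))
      ≈⟨ ∑-comm {k} {n} _ ⟩
    ∑[ a < n ] ∑[ j < k ] (c (toℕ j) * (u a * x a ^ toℕ j))
      ≈⟨ sum-cong-≋ {n} (λ a → trans
           (sum-cong-≋ {k} (λ j → solve 3 (λ c u x → c :* (u :* x) := u :* (c :* x)) refl _ _ _))
           (sym (*-distribˡ-sum {k} (u a) _))) ⟩
    ∑[ a < n ] (u a * ∑[ j < k ] (c (toℕ j) * x a ^ toℕ j))
      ≈⟨ sum-cong-≋ {n} (λ a → *-congˡ (horner-sum k c (x a))) ⟩
    ∑[ a < n ] (u a * horner k c (x a)) ∎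

  sum-isolate : ∀ {n} (t : Fin n → Carrier) i → (∀ j → j ≢ i → t j ≈ 0#) → sum t ≈ t i
  sum-isolate {suc n} t i others≈0 = begin
    sum t                              ≈⟨ sum-remove {i = i} t ⟩
    t i + sum (removeAt t i)           ≈⟨ +-congˡ (sum-cong-≋ {n} (λ j → others≈0 _ (punchInᵢ≢i i j))) ⟩
    t i + ∑[ j < n ] 0#                ≈⟨ +-congˡ (sum-replicate-zero n) ⟩
    t i + 0#                           ≈⟨ +-identityʳ _ ⟩
    t i                                ∎

  -- The Hankel system of power sums and its determinant.

  module Hankel (m : ℕ) (xs : Fin (suc m) → Carrier) where
    private n = suc m
    open AlternatingForms R (Fin n)

    -- The row index ranges over `ℕ` because row `n`, just outside the matrix, is the right-hand
    -- side of the linear system.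
    hankelRow : ℕ → Row
    hankelRow i j = power n xs (suc (i ℕ.+ toℕ j))

    hankel : Fin n → Row
    hankel i = hankelRow (toℕ i)

    vol : Form n
    vol = volume n id

    vol-alt : Alternating n vol
    vol-alt = volume-alternating n id

    power-+ : ∀ i j → power n xs (i ℕ.+ j) ≈ ∑[ a < n ] (xs a ^ i * xs a ^ j)
    power-+ i j = sum-cong-≋ {n} (λ a → ^-homo-* (xs a) i j)

    -- The leading coefficient is 1 (`monic`), so row `n` can be moved across and the system for the
    -- lower coefficients is inhomogeneous.
    recurrence : ∀ j → comb (λ i → coef n xs (toℕ i)) hankel j ≈ - hankelRow n j
    recurrence j = inverseˡ-unique _ _ (begin
      comb (λ i → c (toℕ i)) hankel j + hankelRow n j
        ≈⟨ +-cong lower upper ⟩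
      ∑[ a < n ] (x a * horner n c (xs a)) + ∑[ a < n ] (x a * (c n * xs a ^ n))
        ≈⟨ ∑-distrib-+ {n} (λ a → x a * horner n c (xs a)) (λ a → x a * (c n * xs a ^ n)) ⟨
      ∑[ a < n ] (x a * horner n c (xs a) + x a * (c n * xs a ^ n))
        ≈⟨ sum-cong-≋ {n} root ⟩
      ∑[ a < n ] 0#
        ≈⟨ sum-replicate-zero n ⟩
      0# ∎)
      where
      open import Algebra.Properties.Group +-group using (inverseˡ-unique)
      c = coef n xs
      x : Fin n → Carrier
      x a = xs a ^ suc (toℕ j)
      root : ∀ a → x a * horner n c (xs a) + x a * (c n * xs a ^ n) ≈ 0#
      root a = begin
        x a * horner n c (xs a) + x a * (c n * xs a ^ n)   ≈⟨ distribˡ _ _ _ ⟨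
        x a * (horner n c (xs a) + c n * xs a ^ n)         ≈⟨ *-congˡ (horner-top n c (xs a)) ⟨
        x a * horner (suc n) c (xs a)                      ≈⟨ *-congˡ (horner-coef-root n xs a) ⟩
        x a * 0#                                           ≈⟨ zeroʳ _ ⟩
        0#                                                 ∎
      swap-exponents : ∀ i j → suc (i ℕ.+ j) ≡ suc j ℕ.+ i
      swap-exponents i j = ≡.cong suc (ℕₚ.+-comm i j)
      lower : comb (λ i → c (toℕ i)) hankel j ≈ ∑[ a < n ] (x a * horner n c (xs a))
      lower = trans
        (sum-cong-≋ {n} (λ i → *-congˡ {x = c (toℕ i)} (trans
          (reflexive (≡.cong (power n xs) (swap-exponents (toℕ i) (toℕ j))))
          (power-+ (suc (toℕ j)) (toℕ i)))))
        (combine-moments n c x xs)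
      monic : c n ≈ 1#
      monic = trans (coef-elem n xs n 0 (ℕₚ.+-identityʳ n)) (*-identityˡ 1#)
      upper : hankelRow n j ≈ ∑[ a < n ] (x a * (c n * xs a ^ n))
      upper = trans
        (trans (reflexive (≡.cong (power n xs) (swap-exponents n (toℕ j)))) (power-+ (suc (toℕ j)) n))
        (sum-cong-≋ {n} (λ a → *-congˡ {x = x a}
          (sym (trans (*-congʳ monic) (*-identityˡ (xs a ^ n))))))

    -- Cramer's numerator with two corrections: `sign r` from Vieta's formulas and `sgn k` for the
    -- replaced row standing in front.
    numerator : Fin n → ℕ → Carrier
    numerator k r = sign r * sgn k * vol ((λ j → - hankelRow n j) ∷ removeAt hankel k)

    elem-quotient : ∀ k r → toℕ k ℕ.+ r ≡ n → elem n xs r * vol hankel ≈ numerator k r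
    elem-quotient k r k+r≡n = begin
      elem n xs r * vol hankel
        -- Room for the squares of both signs: one copy of each goes into the Vieta and Cramer
        -- identities, the other stays in `numerator`.
        ≈⟨ solve 2 (λ e v → e :* v := con (+ 1) :* con (+ 1) :* (e :* v)) refl _ _ ⟩
      1# * 1# * (elem n xs r * vol hankel)
        ≈⟨ *-congʳ (*-cong (sign² r) (sgn² k)) ⟨
      sign r * sign r * (sgn k * sgn k) * (elem n xs r * vol hankel)
        ≈⟨ solve 4 (λ s g e v → s :* s :* (g :* g) :* (e :* v) := s :* g :* (s :* e :* (g :* v))) refl _ _ _ _ ⟩
      sign r * sgn k * (sign r * elem n xs r * (sgn k * vol hankel))
        ≈⟨ *-congˡ (*-congʳ (coef-elem n xs (toℕ k) r k+r≡n)) ⟨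
      sign r * sgn k * (coef n xs (toℕ k) * (sgn k * vol hankel))
        ≈⟨ *-congˡ (cramer vol-alt (λ i → coef n xs (toℕ i)) hankel k) ⟨
      sign r * sgn k * vol (comb (λ i → coef n xs (toℕ i)) hankel ∷ removeAt hankel k)
        ≈⟨ *-congˡ (alternating-congruent n vol-alt (∷-cong recurrence (λ _ _ → refl))) ⟩
      numerator k r ∎

    module _ {s} {S : Carrier → Set s} (isSubring : IsSubring S)
             (S-power : ∀ k → S (power n xs (suc k))) where
      open IsSubring isSubring

      vol-closed : ∀ X → (∀ i j → S (X i j)) → S (vol X)
      vol-closed = volume-closed S 1-closed +-closed *-closed neg-closed n id

      hankel-closed : S (vol hankel)
      hankel-closed = vol-closed hankel λ i j → S-power (toℕ i ℕ.+ toℕ j)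

      numerator-closed : ∀ k r → S (numerator k r)
      numerator-closed k r = *-closed (*-closed (sign-closed r) (sgn-closed k)) (vol-closed _ λ
        { zero    j → neg-closed (S-power (n ℕ.+ toℕ j))
        ; (suc i) j → S-power (toℕ (punchIn k i) ℕ.+ toℕ j) })
        where
        sign-closed : ∀ r → S (sign r)
        sign-closed zero    = 1-closed
        sign-closed (suc r) = neg-closed (sign-closed r)
        sgn-closed : ∀ {n} (k : Fin n) → S (sgn k)
        sgn-closed zero    = 1-closed
        sgn-closed (suc k) = neg-closed (sgn-closed k)

    -- The polynomial vanishing at all the xs a except xs b.
    lagrange : Fin n → ℕ → Carrier
    lagrange b = coef m (removeAt xs b)

    lagrange-vanishes : ∀ a b → a ≢ b → horner n (lagrange b) (xs a) ≈ 0#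
    lagrange-vanishes a b a≢b = trans
      (reflexive (≡.cong (horner n (lagrange b) ∘ xs) (≡.sym (punchIn-punchOut (a≢b ∘ ≡.sym)))))
      (horner-coef-root m (removeAt xs b) (punchOut (a≢b ∘ ≡.sym)))

    -- The transpose of the coefficient matrix, so that `comb (hankel i) lagrangeRows` is row `i` of
    -- Hankel · Lᵗ.
    lagrangeRows : Fin n → Row
    lagrangeRows j b = lagrange b (toℕ j)

    diagonalised : Fin n → Row
    diagonalised b = comb (λ i → lagrange b (toℕ i)) (λ i → comb (hankel i) lagrangeRows)

    -- The Hankel matrix is the Gram matrix, on monomials, of the bilinear form taking (f, g) to the
    -- sum of x_a f(x_a) g(x_a); here it is taken on the Lagrange polynomials.
    diagonalised-entry : ∀ b b′ → diagonalised b b′ ≈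
      ∑[ a < n ] (xs a * horner n (lagrange b′) (xs a) * horner n (lagrange b) (xs a))
    diagonalised-entry b b′ = trans
      (sum-cong-≋ {n} (λ i → *-congˡ {x = lagrange b (toℕ i)} (begin
        ∑[ k < n ] (hankel i k * lagrange b′ (toℕ k))
          ≈⟨ sum-cong-≋ {n} (λ k → trans (*-comm (hankel i k) (lagrange b′ (toℕ k)))
                                         (*-congˡ (power-+ (suc (toℕ i)) (toℕ k)))) ⟩
        ∑[ k < n ] (lagrange b′ (toℕ k) * ∑[ a < n ] (xs a ^ suc (toℕ i) * xs a ^ toℕ k))
          ≈⟨ combine-moments n (lagrange b′) (λ a → xs a ^ suc (toℕ i)) xs ⟩
        ∑[ a < n ] (xs a ^ suc (toℕ i) * horner n (lagrange b′) (xs a))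
          ≈⟨ sum-cong-≋ {n} (λ a → solve 3 (λ x p h → x :* p :* h := x :* h :* p)
               refl (xs a) (xs a ^ toℕ i) (horner n (lagrange b′) (xs a))) ⟩
        ∑[ a < n ] (xs a * horner n (lagrange b′) (xs a) * xs a ^ toℕ i) ∎)))
      (combine-moments n (lagrange b) (λ a → xs a * horner n (lagrange b′) (xs a)) xs)

    rootDifferences : Fin n → Carrier
    rootDifferences b = product (λ c → xs b - removeAt xs b c)

    discriminantFactor : Fin n → Carrier
    discriminantFactor b = xs b * rootDifferences b * rootDifferences b

    vol-diagonalised : vol diagonalised ≈ product discriminantFactor
    vol-diagonalised = trans
      (volume-diagonal n id diagonalised λ b b′ b≢b′ → trans (diagonalised-entry b b′)
        (trans (sum-isolate {n} _ b (off b b′))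
          (trans (*-congʳ (trans (*-congˡ (lagrange-vanishes b b′ b≢b′)) (zeroʳ _))) (zeroˡ _))))
      (product-cong {n} (λ b → trans (diagonalised-entry b b) (trans (sum-isolate {n} _ b (off b b))
        (*-cong (*-congˡ (horner-coef m (removeAt xs b) (xs b))) (horner-coef m (removeAt xs b) (xs b))))))
      where
      off : ∀ b b′ a → a ≢ b → xs a * horner n (lagrange b′) (xs a) * horner n (lagrange b) (xs a) ≈ 0#
      off b b′ a a≢b = trans (*-congˡ (lagrange-vanishes a b a≢b)) (zeroʳ _)

    identity : Fin n → Row
    identity i j = if does (i Fin.≟ j) then 1# else 0#

    identity-diagonal : ∀ i → identity i i ≈ 1#
    identity-diagonal i = reflexive (≡.cong (if_then 1# else 0#) (dec-true (i Fin.≟ i) ≡.refl))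

    identity-off-diagonal : ∀ i j → i ≢ j → identity i j ≈ 0#
    identity-off-diagonal i j i≢j = reflexive (≡.cong (if_then 1# else 0#) (dec-false (i Fin.≟ j) i≢j))

    vol-identity : vol identity ≈ 1#
    vol-identity = trans (volume-diagonal n id identity identity-off-diagonal)
      (trans (product-cong {n} identity-diagonal) (product-replicate-one n))

    -- `det-mult` at the identity matrix. It lets a hypothesis on `vol hankel` reach the factor
    -- `det n hankel` in `degenerate`.
    vol-det : ∀ A → vol A ≈ det n A
    vol-det A = begin
      vol A                               ≈⟨ alternating-congruent n vol-alt (λ i j → sym (expand i j)) ⟩
      vol (λ i → comb (A i) identity)     ≈⟨ det-mult vol-alt A identity ⟩
      det n A * vol identity              ≈⟨ trans (*-congˡ vol-identity) (*-identityʳ _) ⟩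
      det n A                             ∎
      where
      expand : ∀ i j → comb (A i) identity j ≈ A i j
      expand i j = trans
        (sum-isolate {n} _ j (λ k k≢j → trans (*-congˡ {x = A i k} (identity-off-diagonal k j k≢j)) (zeroʳ _)))
        (trans (*-congˡ (identity-diagonal j)) (*-identityʳ _))

    degenerate : vol hankel ≈ 0# → product discriminantFactor ≈ 0#
    degenerate vol≈0 = begin
      product discriminantFactor
        ≈⟨ vol-diagonalised ⟨
      vol diagonalised
        ≈⟨ det-mult vol-alt L (λ i → comb (hankel i) lagrangeRows) ⟩
      det n L * vol (λ i → comb (hankel i) lagrangeRows)
        ≈⟨ *-congˡ (det-mult vol-alt hankel lagrangeRows) ⟩
      det n L * (det n hankel * vol lagrangeRows)
        ≈⟨ *-congˡ (*-congʳ (trans (sym (vol-det hankel)) vol≈0)) ⟩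
      det n L * (0# * vol lagrangeRows)
        ≈⟨ solve 2 (λ x y → x :* (con (+ 0) :* y) := con (+ 0)) refl _ _ ⟩
      0# ∎
      where L = λ b i → lagrange b (toℕ i)

-- Non-zero-divisors.

module Regularity {r ℓ : Level} (R : CommutativeRing r ℓ) where
  open CommutativeRing R hiding (zero)
  open import Algebra.Properties.CommutativeMonoid.Sum *-commutativeMonoid
    using () renaming (sum to product)

  -- Stronger than being nonzero in a nontrivial ring, and stable under products without deciding
  -- which factor vanishes.
  Regular : Carrier → Set (r ⊔ ℓ)
  Regular x = ∀ y → y * x ≈ 0# → y ≈ 0#

  *-regular : ∀ {x x′} → Regular x → Regular x′ → Regular (x * x′)
  *-regular reg reg′ y yxx′≈0 = reg y (reg′ _ (trans (*-assoc _ _ _) yxx′≈0))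

  product-regular : ∀ {n} (t : Fin n → Carrier) → (∀ i → Regular (t i)) → Regular (product t)
  product-regular {zero}  t reg y y1≈0 = trans (sym (*-identityʳ y)) y1≈0
  product-regular {suc n} t reg        = *-regular (reg zero) (product-regular (t ∘ suc) (reg ∘ suc))

  regular⇒nonzero : ∀ {x} → ¬ (0# ≈ 1#) → Regular x → ¬ (x ≈ 0#)
  regular⇒nonzero 0≉1 reg x≈0 = 0≉1 (sym (reg 1# (trans (*-identityˡ _) x≈0)))

-- Formal power series and regular elements among them.

module PowerSeries {r ℓ : Level} (R : CommutativeRing r ℓ) where
  open CommutativeRing R hiding (zero)
  open IntegerCoefficients R

  Series : Set r
  Series = ℕ → Carrier

  infix  4 _≈ₛ_
  infixl 7 _*ₛ_

  _≈ₛ_ : Series → Series → Set ℓ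
  f ≈ₛ g = ∀ k → f k ≈ g k

  constant : Carrier → Series
  constant a zero    = a
  constant a (suc k) = 0#

  -- The Cauchy product by recursion on the first factor, read as f 0 + t · (f ∘ suc).
  _*ₛ_ : Series → Series → Series
  (f *ₛ g) zero    = f 0 * g 0
  (f *ₛ g) (suc k) = f 0 * g (suc k) + (f ∘ suc *ₛ g) k

  *ₛ-cong : ∀ {f f′ g g′} → f ≈ₛ f′ → g ≈ₛ g′ → f *ₛ g ≈ₛ f′ *ₛ g′
  *ₛ-cong f≈ g≈ zero    = *-cong (f≈ 0) (g≈ 0)
  *ₛ-cong f≈ g≈ (suc k) = +-cong (*-cong (f≈ 0) (g≈ (suc k))) (*ₛ-cong (f≈ ∘ suc) g≈ k)

  -- The tail of a product has the form `a * f i + g i`, so this is the rule that associativity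
  -- calls for.
  *ₛ-linear : ∀ a f g h k → ((λ i → a * f i + g i) *ₛ h) k ≈ a * (f *ₛ h) k + (g *ₛ h) k
  *ₛ-linear a f g h zero    = solve 4 (λ a f g h → (a :* f :+ g) :* h := a :* (f :* h) :+ g :* h) refl _ _ _ _
  *ₛ-linear a f g h (suc k) = trans (+-congˡ (*ₛ-linear a (f ∘ suc) (g ∘ suc) h k))
    (solve 6 (λ a f g h s t → (a :* f :+ g) :* h :+ (a :* s :+ t) := a :* (f :* h :+ s) :+ (g :* h :+ t))
      refl _ _ _ _ _ _)

  *ₛ-zeroˡ : ∀ f g → (∀ k → f k ≈ 0#) → ∀ k → (f *ₛ g) k ≈ 0#
  *ₛ-zeroˡ f g f≈0 zero    = trans (*-congʳ (f≈0 0)) (zeroˡ _)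
  *ₛ-zeroˡ f g f≈0 (suc k) = trans
    (+-cong (trans (*-congʳ (f≈0 0)) (zeroˡ _)) (*ₛ-zeroˡ (f ∘ suc) g (f≈0 ∘ suc) k)) (+-identityˡ 0#)

  -- The mirror image of the defining recursion; commutativity matches the two.
  *ₛ-shiftʳ : ∀ f g k → (f *ₛ g) (suc k) ≈ (f *ₛ (g ∘ suc)) k + f (suc k) * g 0
  *ₛ-shiftʳ f g zero    = refl
  *ₛ-shiftʳ f g (suc k) = trans (+-congˡ (*ₛ-shiftʳ (f ∘ suc) g k)) (sym (+-assoc _ _ _))

  *ₛ-comm : ∀ f g → f *ₛ g ≈ₛ g *ₛ f
  *ₛ-comm f g zero    = *-comm _ _
  *ₛ-comm f g (suc k) = trans (+-cong (*-comm _ _) (*ₛ-comm (f ∘ suc) g k))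
    (trans (+-comm _ _) (sym (*ₛ-shiftʳ g f k)))

  *ₛ-assoc : ∀ f g h → (f *ₛ g) *ₛ h ≈ₛ f *ₛ (g *ₛ h)
  *ₛ-assoc f g h zero    = *-assoc _ _ _
  *ₛ-assoc f g h (suc k) = trans
    (+-congˡ (trans (*ₛ-linear (f 0) (g ∘ suc) (f ∘ suc *ₛ g) h k) (+-congˡ (*ₛ-assoc (f ∘ suc) g h k))))
    (solve 5 (λ f g h s t → f :* g :* h :+ (f :* s :+ t) := f :* (g :* h :+ s) :+ t) refl _ _ _ _ _)

  *ₛ-constant : ∀ a f k → (constant a *ₛ f) k ≈ a * f k
  *ₛ-constant a f zero    = refl
  *ₛ-constant a f (suc k) = trans (+-congˡ (*ₛ-zeroˡ _ f (λ _ → refl) k)) (+-identityʳ _)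

  *ₛ-identityˡ : ∀ f → constant 1# *ₛ f ≈ₛ f
  *ₛ-identityˡ f k = trans (*ₛ-constant 1# f k) (*-identityˡ _)

  *ₛ-distribʳ : ∀ h f g → (λ i → f i + g i) *ₛ h ≈ₛ (λ k → (f *ₛ h) k + (g *ₛ h) k)
  *ₛ-distribʳ h f g k = trans (*ₛ-cong {g = h} (λ i → +-congʳ (sym (*-identityˡ (f i)))) (λ _ → refl) k)
    (trans (*ₛ-linear 1# f g h k) (+-congʳ (*-identityˡ _)))

  *ₛ-distribˡ : ∀ h f g → h *ₛ (λ i → f i + g i) ≈ₛ (λ k → (h *ₛ f) k + (h *ₛ g) k)
  *ₛ-distribˡ h f g k = trans (*ₛ-comm h _ k) (trans (*ₛ-distribʳ h f g k)
    (+-cong (*ₛ-comm f h k) (*ₛ-comm g h k)))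

  series : CommutativeRing r ℓ
  series = record
    { Carrier = Series
    ; _≈_ = _≈ₛ_
    ; _+_ = λ f g k → f k + g k
    ; _*_ = _*ₛ_
    ; -_  = λ f k → - f k
    ; 0#  = λ _ → 0#
    ; 1#  = constant 1#
    ; isCommutativeRing = record
      { isRing = record
        { +-isAbelianGroup = record
          { isGroup = record
            { isMonoid = record
              { isSemigroup = record
                { isMagma = record
                  { isEquivalence = record
                    { refl  = λ _ → refl
                    ; sym   = λ f≈g k → sym (f≈g k)
                    ; trans = λ f≈g g≈h k → trans (f≈g k) (g≈h k)
                    }
                  ; ∙-cong = λ f≈ g≈ k → +-cong (f≈ k) (g≈ k)
                  }
                ; assoc = λ _ _ _ _ → +-assoc _ _ _
                }
              ; identity = (λ _ _ → +-identityˡ _) , (λ _ _ → +-identityʳ _)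
              }
            ; inverse = (λ _ _ → -‿inverseˡ _) , (λ _ _ → -‿inverseʳ _)
            ; ⁻¹-cong = λ f≈ k → -‿cong (f≈ k)
            }
          ; comm = λ _ _ _ → +-comm _ _
          }
        ; *-cong     = *ₛ-cong
        ; *-assoc    = *ₛ-assoc
        ; *-identity = *ₛ-identityˡ , λ f k → trans (*ₛ-comm f _ k) (*ₛ-identityˡ f k)
        ; distrib    = *ₛ-distribˡ , *ₛ-distribʳ
        }
      ; *-comm = *ₛ-comm
      }
    }

  open Regularity series

  -- If g f = 0, the constant term gives g 0 = 0; then `g ∘ suc` annihilates `f` too, and its
  -- coefficients follow in turn.
  unit-head-regular : ∀ f u → f 0 * u ≈ 1# → Regular f
  unit-head-regular f u fu≈1 = λ g gf≈0 k → go k g gf≈0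
    where
    head : ∀ g → g *ₛ f ≈ₛ (λ _ → 0#) → g 0 ≈ 0#
    head g gf≈0 = trans (trans (sym (*-identityʳ _)) (*-congˡ (sym fu≈1)))
      (trans (sym (*-assoc _ _ _)) (trans (*-congʳ (gf≈0 0)) (zeroˡ u)))
    go : ∀ k g → g *ₛ f ≈ₛ (λ _ → 0#) → g k ≈ 0#
    go zero    g gf≈0 = head g gf≈0
    go (suc k) g gf≈0 = go k (g ∘ suc) λ i → trans
      (sym (trans (+-congʳ (trans (*-congʳ (head g gf≈0)) (zeroˡ _))) (+-identityˡ _))) (gf≈0 (suc i))

  shift-regular : ∀ f → f 0 ≈ 0# → Regular (f ∘ suc) → Regular f
  shift-regular f f₀≈0 reg g gf≈0 = reg g λ k → trans
    (sym (trans (*ₛ-shiftʳ g f k) (trans (+-congˡ (trans (*-congˡ f₀≈0) (zeroʳ _))) (+-identityʳ _))))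
    (gf≈0 (suc k))

  monomial : ℕ → Series
  monomial zero            = constant 1#
  monomial (suc a) zero    = 0#
  monomial (suc a) (suc k) = monomial a k

  monomial-regular : ∀ a → Regular (monomial a)
  monomial-regular zero    = unit-head-regular _ 1# (*-identityˡ 1#)
  monomial-regular (suc a) = shift-regular _ refl (monomial-regular a)

  -- Common powers of t are stripped until one exponent is 0; the constant term is then 1 or -1, a
  -- unit in every characteristic.
  difference-regular : ∀ a b → a ≢ b → Regular (λ k → monomial a k - monomial b k)
  difference-regular zero    zero    a≢b = contradiction ≡.refl a≢b
  difference-regular zero    (suc b) a≢b = unit-head-regular _ 1#
    (solve 0 ((con (+ 1) :- con (+ 0)) :* con (+ 1) := con (+ 1)) refl)
  difference-regular (suc a) zero    a≢b = unit-head-regular _ (- 1#)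
    (solve 0 ((con (+ 0) :- con (+ 1)) :* :- con (+ 1) := con (+ 1)) refl)
  difference-regular (suc a) (suc b) a≢b = shift-regular _ (-‿inverseʳ 0#)
    (difference-regular a b (a≢b ∘ ≡.cong suc))

-- The polynomial ring and evaluation of its expressions.

module PolynomialRing {c ℓ : Level} (K : Field c ℓ) (n : ℕ) where
  open Polynomials K n
  open Field K using (0#; 1#)

  polyRing : CommutativeRing c (c ⊔ ℓ)
  polyRing = record
    { Carrier = Poly
    ; _≈_ = _≋_
    ; _+_ = _⊕_
    ; _*_ = _⊗_
    ; -_  = ⊖_
    ; 0#  = con 0#
    ; 1#  = con 1#
    ; isCommutativeRing = record
      { isRing = record
        { +-isAbelianGroup = record
          { isGroup = record
            { isMonoid = record
              { isSemigroup = record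
                { isMagma = record
                  { isEquivalence = record { refl = ≋-refl ; sym = ≋-sym ; trans = ≋-trans }
                  ; ∙-cong = ⊕-cong
                  }
                ; assoc = ⊕-assoc
                }
              ; identity = ⊕-idˡ , λ p → ≋-trans (⊕-comm p _) (⊕-idˡ p)
              }
            ; inverse = ⊖-invˡ , λ p → ≋-trans (⊕-comm p _) (⊖-invˡ p)
            ; ⁻¹-cong = ⊖-cong
            }
          ; comm = ⊕-comm
          }
        ; *-cong     = ⊗-cong
        ; *-assoc    = ⊗-assoc
        ; *-identity = ⊗-idˡ , λ p → ≋-trans (⊗-comm p _) (⊗-idˡ p)
        ; distrib    = distribˡ , λ r p q → ≋-trans (⊗-comm _ r)
                         (≋-trans (distribˡ r p q) (⊕-cong (⊗-comm r p) (⊗-comm r q)))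
        }
      ; *-comm = ⊗-comm
      }
    }

module Evaluation {c ℓ r ℓ′ : Level} (K : Field c ℓ) (R : CommutativeRing r ℓ′)
                  (ι : Field.Carrier K → CommutativeRing.Carrier R) where
  open Polynomials K using (Poly)
  open CommutativeRing R hiding (zero)
  open import Algebra.Properties.CommutativeMonoid.Sum *-commutativeMonoid
    using () renaming (sum to product)
  open SymmetricFunctions R using (elem)
  private module K = Field K

  ⟦_⟧ : ∀ {m} → Poly m → (Fin m → Carrier) → Carrier
  ⟦ Polynomials.con a ⟧ ρ = ι a
  ⟦ Polynomials.var i ⟧ ρ = ρ i
  ⟦ p Polynomials.⊕ q ⟧ ρ = ⟦ p ⟧ ρ + ⟦ q ⟧ ρ
  ⟦ p Polynomials.⊗ q ⟧ ρ = ⟦ p ⟧ ρ * ⟦ q ⟧ ρ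
  ⟦ Polynomials.⊖ p   ⟧ ρ = - ⟦ p ⟧ ρ

  ⟦shift⟧ : ∀ {m} (p : Poly m) ρ → ⟦ shift K p ⟧ ρ ≡ ⟦ p ⟧ (ρ ∘ suc)
  ⟦shift⟧ (Polynomials.con a) ρ = ≡.refl
  ⟦shift⟧ (Polynomials.var i) ρ = ≡.refl
  ⟦shift⟧ (p Polynomials.⊕ q) ρ = ≡.cong₂ _+_ (⟦shift⟧ p ρ) (⟦shift⟧ q ρ)
  ⟦shift⟧ (p Polynomials.⊗ q) ρ = ≡.cong₂ _*_ (⟦shift⟧ p ρ) (⟦shift⟧ q ρ)
  ⟦shift⟧ (Polynomials.⊖ p)   ρ = ≡.cong -_ (⟦shift⟧ p ρ)

  module _ (ι-1 : ι K.1# ≈ 1#) where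

    -- Evaluation computes through `⊗`, but a `foldr` over an unknown number of factors is stuck
    -- until induction opens it.
    ⟦product⟧ : ∀ {m n} (t : Fin n → Poly m) ρ →
                ⟦ Vector.foldr Polynomials._⊗_ (Polynomials.con K.1#) t ⟧ ρ ≈ product (λ i → ⟦ t i ⟧ ρ)
    ⟦product⟧ {n = zero}  t ρ = ι-1
    ⟦product⟧ {n = suc n} t ρ = *-congˡ (⟦product⟧ (t ∘ suc) ρ)

    module _ (ι-0 : ι K.0# ≈ 0#) where

      ⟦esym⟧ : ∀ m k ρ → ⟦ esym K m k ⟧ ρ ≈ elem m ρ k
      ⟦esym⟧ m       zero    ρ = ι-1
      ⟦esym⟧ zero    (suc k) ρ = ι-0
      ⟦esym⟧ (suc m) (suc k) ρ = +-cong
        (trans (reflexive (⟦shift⟧ (esym K m (suc k)) ρ)) (⟦esym⟧ m (suc k) (ρ ∘ suc)))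
        (*-congˡ (trans (reflexive (⟦shift⟧ (esym K m k) ρ)) (⟦esym⟧ m k (ρ ∘ suc))))

  module _ (ι-cong : ∀ {a b} → a K.≈ b → ι a ≈ ι b)
           (ι-+ : ∀ a b → ι (a K.+ b) ≈ ι a + ι b) (ι-* : ∀ a b → ι (a K.* b) ≈ ι a * ι b)
           (ι-- : ∀ a → ι (K.- a) ≈ - ι a) (ι-0 : ι K.0# ≈ 0#) (ι-1 : ι K.1# ≈ 1#)
           {m : ℕ} (ρ : Fin m → Carrier) where
    open Polynomials K m hiding (Poly)

    -- The universal property of the free algebra, by induction on the derivation of `p ≋ q`.
    ⟦⟧-sound : ∀ {p q : Poly m} → p ≋ q → ⟦ p ⟧ ρ ≈ ⟦ q ⟧ ρ
    ⟦⟧-sound ≋-refl           = refl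
    ⟦⟧-sound (≋-sym e)        = sym (⟦⟧-sound e)
    ⟦⟧-sound (≋-trans e e′)   = trans (⟦⟧-sound e) (⟦⟧-sound e′)
    ⟦⟧-sound (⊕-cong e e′)    = +-cong (⟦⟧-sound e) (⟦⟧-sound e′)
    ⟦⟧-sound (⊗-cong e e′)    = *-cong (⟦⟧-sound e) (⟦⟧-sound e′)
    ⟦⟧-sound (⊖-cong e)       = -‿cong (⟦⟧-sound e)
    ⟦⟧-sound (con-cong a≈b)   = ι-cong a≈b
    ⟦⟧-sound (con-+ a b)      = ι-+ a b
    ⟦⟧-sound (con-* a b)      = ι-* a b
    ⟦⟧-sound (con-- a)        = ι-- a
    ⟦⟧-sound (⊕-assoc p q r)  = +-assoc _ _ _
    ⟦⟧-sound (⊕-comm p q)     = +-comm _ _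
    ⟦⟧-sound (⊕-idˡ p)        = trans (+-congʳ ι-0) (+-identityˡ _)
    ⟦⟧-sound (⊖-invˡ p)       = trans (-‿inverseˡ _) (sym ι-0)
    ⟦⟧-sound (⊗-assoc p q r)  = *-assoc _ _ _
    ⟦⟧-sound (⊗-comm p q)     = *-comm _ _
    ⟦⟧-sound (⊗-idˡ p)        = trans (*-congʳ ι-1) (*-identityˡ _)
    ⟦⟧-sound (distribˡ p q r) = CommutativeRing.distribˡ R _ _ _

module Elementary {c ℓ : Level} (K : Field c ℓ) (n : ℕ) where
  open Polynomials K n
  open PolynomialRing K n
  open CommutativeRing polyRing using (semiring; reflexive)
  open SymmetricFunctions polyRing using (elem; power)
  open Evaluation K polyRing con
  open import Algebra.Properties.Semiring.Exp semiring using () renaming (_^_ to _^ᴿ_)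
  open import Algebra.Properties.Semiring.Sum semiring using (sum; sum-cong-≗)

  ⟦⟧-var : ∀ p → ⟦ p ⟧ var ≡ p
  ⟦⟧-var (con a) = ≡.refl
  ⟦⟧-var (var i) = ≡.refl
  ⟦⟧-var (p ⊕ q) = ≡.cong₂ _⊕_ (⟦⟧-var p) (⟦⟧-var q)
  ⟦⟧-var (p ⊗ q) = ≡.cong₂ _⊗_ (⟦⟧-var p) (⟦⟧-var q)
  ⟦⟧-var (⊖ p)   = ≡.cong ⊖_ (⟦⟧-var p)

  -- Evaluation at the generators returns the expression itself, while on `esym` it absorbs every
  -- `shift`.
  esym≋elem : ∀ k → esym K n k ≋ elem n var k
  esym≋elem k = ≋-trans (reflexive (≡.sym (⟦⟧-var (esym K n k)))) (⟦esym⟧ ≋-refl ≋-refl n k var)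

  ^≡^ : ∀ p k → p ^ k ≡ p ^ᴿ k
  ^≡^ p zero    = ≡.refl
  ^≡^ p (suc k) = ≡.cong (p ⊗_) (^≡^ p k)

  sumP-tabulate : ∀ {m} (t : Fin m → Poly) → sumP (List.tabulate t) ≡ sum t
  sumP-tabulate {zero}  t = ≡.refl
  sumP-tabulate {suc m} t = ≡.cong (t zero ⊕_) (sumP-tabulate (t ∘ suc))

  powerSum≋power : ∀ k → powerSum k ≋ power n var k
  powerSum≋power k = reflexive (≡.trans
    (≡.cong sumP (map-tabulate id (λ i → var i ^ k)))
    (≡.trans (sumP-tabulate (λ i → var i ^ k)) (sum-cong-≗ (λ i → ^≡^ (var i) k))))

-- The Hankel determinant is nonzero.

module HankelNonzero {c ℓ : Level} (K : Field c ℓ) (m : ℕ) where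
  private n = suc m
  open Field K using (commutativeRing; 0#; 1#; 0≉1)
  private module K = Field K
  open PowerSeries commutativeRing
  open Regularity series
  open Polynomials K n
  open PolynomialRing K n
  open Evaluation K series constant
  open SymmetricFunctions.Hankel polyRing m var
  private module S = CommutativeRing series

  -- Distinct exponents send each difference of two variables to a regular series.
  point : Fin n → Series
  point i = monomial (suc (toℕ i))

  constant-cong : ∀ {a b} → a K.≈ b → constant a ≈ₛ constant b
  constant-cong a≈b zero    = a≈b
  constant-cong a≈b (suc k) = K.refl

  constant-+ : ∀ a b → constant (a K.+ b) ≈ₛ constant a S.+ constant b
  constant-+ a b zero    = K.refl
  constant-+ a b (suc k) = K.sym (K.+-identityˡ 0#)

  constant-* : ∀ a b → constant (a K.* b) ≈ₛ constant a *ₛ constant b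
  constant-* a b zero    = K.refl
  constant-* a b (suc k) = K.sym (K.trans (*ₛ-constant a (constant b) (suc k)) (K.zeroʳ a))

  constant-neg : ∀ a → constant (K.- a) ≈ₛ S.- constant a
  constant-neg a zero    = K.refl
  constant-neg a (suc k) = K.sym -0#≈0#
    where open import Algebra.Properties.Ring K.ring using (-0#≈0#)

  constant-0 : constant 0# ≈ₛ S.0#
  constant-0 zero    = K.refl
  constant-0 (suc k) = K.refl

  evaluate-sound : ∀ {p q} → p ≋ q → ⟦ p ⟧ point ≈ₛ ⟦ q ⟧ point
  evaluate-sound = ⟦⟧-sound constant-cong constant-+ constant-* constant-neg constant-0 (λ _ → K.refl) point

  Regular-resp : ∀ {f g} → f ≈ₛ g → Regular f → Regular g
  Regular-resp f≈g reg y yg≈0 = reg y (S.trans (S.*-congˡ {x = y} f≈g) yg≈0)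

  product-point-regular : ∀ {k} (t : Fin k → Poly) → (∀ i → Regular (⟦ t i ⟧ point)) →
                          Regular (⟦ Vector.foldr _⊗_ (con 1#) t ⟧ point)
  product-point-regular t reg = Regular-resp (S.sym (⟦product⟧ (λ _ → K.refl) t point)) (product-regular _ reg)

  factor-regular : ∀ b → Regular (⟦ discriminantFactor b ⟧ point)
  factor-regular b = *-regular (*-regular (monomial-regular (suc (toℕ b))) differences) differences
    where
    differences : Regular (⟦ rootDifferences b ⟧ point)
    differences = product-point-regular _ λ i →
      difference-regular _ _ (λ eq → punchInᵢ≢i b i (≡.sym (toℕ-injective (ℕₚ.suc-injective eq))))

  hankel-nonzero : ¬ (vol hankel ≋ con 0#)
  hankel-nonzero vol≋0 = regular⇒nonzero (λ 0≈1 → 0≉1 (0≈1 0))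
    (product-point-regular discriminantFactor factor-regular)
    (S.trans (evaluate-sound (degenerate vol≋0)) constant-0)

-- Polynomials inside a generated subfield.

module GeneratedSubfield {c ℓ s : Level} (K : Field c ℓ) (n : ℕ)
    (1≉0 : ¬ Polynomials._≋_ K n (Polynomials.con (Field.1# K)) (Polynomials.con (Field.0# K)))
    (S : RationalFunctions.Frac K n → Set s) where
  open Field K using (0#; 1#)
  open RationalFunctions K n
  open PolynomialRing K n
  open IntegerCoefficients polyRing hiding (con)
  open IntegerCoefficients polyRing using () renaming (con to con′)
  open Subrings polyRing

  polynomial : Poly → Frac
  polynomial p = p / con 1# ∣ 1≉0

  Generated : Poly → Set _
  Generated p = Gen S (polynomial p)

  constant-generated : ∀ a → Generated (con a)
  constant-generated a = gen-K _ a (≋-sym (solve 1 (λ x → x :* con′ (+ 1) := x) ≋-refl (con a)))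

  -- Adding the zero fraction changes the representative, since `gen-add` accepts any fraction equal
  -- to the sum.
  generated-≃ : ∀ {p} → Generated p → ∀ h → h ≃P p → Gen S h
  generated-≃ {p} Gp h h≃p = gen-add (polynomial p) (polynomial (con 0#)) h Gp (constant-generated 0#)
    (≋-trans (⊗-cong h≃p ≋-refl) (solve 2
      (λ p d → p :* d :* (con′ (+ 1) :* con′ (+ 1)) := (p :* con′ (+ 1) :+ con′ (+ 0) :* con′ (+ 1)) :* d)
      ≋-refl p (den h)))

  generated-subring : IsSubring Generated
  generated-subring = record
    { resp       = λ p≋q Gp → generated-≃ Gp _ (≋-trans (≋-sym p≋q)
                     (≋-sym (solve 1 (λ x → x :* con′ (+ 1) := x) ≋-refl _)))
    ; 1-closed   = constant-generated 1#
    ; +-closed   = λ Gp Gq → gen-add _ _ _ Gp Gq (solve 2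
                     (λ p q → (p :+ q) :* (con′ (+ 1) :* con′ (+ 1))
                           := (p :* con′ (+ 1) :+ q :* con′ (+ 1)) :* con′ (+ 1))
                     ≋-refl _ _)
    ; *-closed   = λ Gp Gq → gen-mul _ _ _ Gp Gq (solve 2
                     (λ p q → p :* q :* (con′ (+ 1) :* con′ (+ 1)) := p :* q :* con′ (+ 1)) ≋-refl _ _)
    ; neg-closed = λ Gp → gen-neg _ _ Gp ≋-refl
    }

  -- The one division of the argument, where a subfield is required instead of a subring.
  quotient-generated : ∀ {p q} → Generated p → Generated q → ¬ (q ≋ con 0#) →
                       ∀ h → num h ⊗ q ≋ p ⊗ den h → Gen S h
  quotient-generated {p} {q} Gp Gq q≉0 h eq =
    gen-mul (polynomial p) (con 1# / q ∣ q≉0) h Gp (gen-inv (polynomial q) _ Gq q≉0 ≋-refl)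
      (≋-trans (⊗-cong ≋-refl (⊗-idˡ q))
        (≋-trans eq (⊗-cong (≋-sym (solve 1 (λ x → x :* con′ (+ 1) := x) ≋-refl p)) ≋-refl)))

-- Comparing generators: the two inclusions.

Gen-mono : ∀ {c ℓ s t} (K : Field c ℓ) n → let open RationalFunctions K n in
           {S : Frac → Set s} {T : Frac → Set t} → (∀ h → S h → Gen T h) → ∀ h → Gen S h → Gen T h
Gen-mono K n {S} {T} S⊆T = go
  where
  open RationalFunctions K n
  go : ∀ h → Gen S h → Gen T h
  go h (gen-K _ a eq)           = gen-K h a eq
  go h (gen-S _ Sh)             = S⊆T h Sh
  go h (gen-add f g _ Gf Gg eq) = gen-add f g h (go f Gf) (go g Gg) eq
  go h (gen-mul f g _ Gf Gg eq) = gen-mul f g h (go f Gf) (go g Gg) eq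
  go h (gen-neg f _ Gf eq)      = gen-neg f h (go f Gf) eq
  go h (gen-inv f _ Gf nz eq)   = gen-inv f h (go f Gf) nz eq

theorem1p3 : {c ℓ : Level} (K : Field c ℓ) (n : ℕ) → 1 ≤ n →
    let open RationalFunctions K n in
    ((f : Frac) → Gen ElemSet f → Gen PowerSet f) ×
    ((f : Frac) → Gen PowerSet f → Gen ElemSet f)
theorem1p3 K (suc m) 1≤n = Gen-mono K n elem⊆power , Gen-mono K n power⊆elem
  where
  n = suc m
  open RationalFunctions K n
  open Field K using (0#; 1#; 0≉1)
  open PolynomialRing K n
  open SymmetricFunctions polyRing using (elem; power; elem-vanishes; power-closed)
  open SymmetricFunctions.Hankel polyRing m var
  open Subrings polyRing using (module IsSubring)
  open HankelNonzero K m
  open Elementary K n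

  1≉0 : ¬ (con 1# ≋ con 0#)
  1≉0 1≋0 = 0≉1 (Field.sym K (evaluate-sound 1≋0 0))

  module Power = GeneratedSubfield K n 1≉0 PowerSet
  module Elem = GeneratedSubfield K n 1≉0 ElemSet

  p≋p⊗1 : ∀ p → p ≋ p ⊗ con 1#
  p≋p⊗1 p = ≋-sym (CommutativeRing.*-identityʳ polyRing p)

  power-generated : ∀ k → Power.Generated (power n var (suc k))
  power-generated k = IsSubring.resp Power.generated-subring (powerSum≋power (suc k))
    (gen-S _ (suc k , s≤s z≤n , p≋p⊗1 _))

  elem⊆power : ∀ h → ElemSet h → Gen PowerSet h
  elem⊆power h (suc r , _ , s≤s r≤m , h≃e) = Power.quotient-generated
    (numerator-closed Power.generated-subring power-generated k (suc r))
    (hankel-closed Power.generated-subring power-generated)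
    hankel-nonzero h eq
    where
    open CommutativeRing polyRing using (setoid; *-assoc)
    open import Relation.Binary.Reasoning.Setoid setoid
    -- e_{r+1} is up to sign the coefficient of T^(m-r), so row m - r is the one that Cramer's rule
    -- replaces.
    k<n : m ∸ r ℕ.< n
    k<n = s≤s (ℕₚ.m∸n≤m m r)
    k = fromℕ< k<n
    k+r≡n : toℕ k ℕ.+ suc r ≡ n
    k+r≡n = ≡.trans (≡.cong (ℕ._+ suc r) (toℕ-fromℕ< k<n))
      (≡.trans (ℕₚ.+-suc _ _) (≡.cong suc (ℕₚ.m∸n+n≡m r≤m)))
    eq : num h ⊗ vol hankel ≋ numerator k (suc r) ⊗ den h
    eq = begin
      num h ⊗ vol hankel                          ≈⟨ ⊗-cong h≃e ≋-refl ⟩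
      esym K n (suc r) ⊗ den h ⊗ vol hankel       ≈⟨ *-assoc _ _ _ ⟩
      esym K n (suc r) ⊗ (den h ⊗ vol hankel)     ≈⟨ ⊗-cong (esym≋elem (suc r)) (⊗-comm _ _) ⟩
      elem n var (suc r) ⊗ (vol hankel ⊗ den h)   ≈⟨ *-assoc _ _ _ ⟨
      elem n var (suc r) ⊗ vol hankel ⊗ den h     ≈⟨ ⊗-cong (elem-quotient k (suc r) k+r≡n) ≋-refl ⟩
      numerator k (suc r) ⊗ den h                 ∎

  -- Newton's identities refer to every index, so the values outside `ElemSet` are supplied as
  -- constants: 1 for k = 0 and 0 beyond `n`.
  elem-generated : ∀ k → Elem.Generated (elem n var k)
  elem-generated zero    = Elem.constant-generated 1#
  elem-generated (suc k) with suc k ℕₚ.≤? n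
  ... | yes k≤n = IsSubring.resp Elem.generated-subring (esym≋elem (suc k))
                    (gen-S _ (suc k , s≤s z≤n , k≤n , p≋p⊗1 _))
  ... | no  k≰n = IsSubring.resp Elem.generated-subring
                    (≋-sym (elem-vanishes n var (suc k) (ℕₚ.≰⇒> k≰n))) (Elem.constant-generated 0#)

  power⊆elem : ∀ h → PowerSet h → Gen ElemSet h
  power⊆elem h (suc k , _ , h≃p) = Elem.generated-≃ (IsSubring.resp Elem.generated-subring
    (≋-sym (powerSum≋power (suc k)))
    (power-closed Elem.generated-subring n var elem-generated k)) h h≃p
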